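{- Let $\mathcal{R}$ be a symmetric association scheme. If there is at most one non-trivial relation in $\mathcal{R}$ that is neither strongly regular of Latin square type nor strongly regular of negative Latin square type, then $\mathcal{R}$ is amorphic.
   Context: A symmetric $d$-class association scheme on a finite set $X$ with $|X|=v$ is a set $\mathcal{R}=\{A_0,\dots,A_d\}$ of $X\times X$ $01$-matrices with $A_0=I$, $\sum_iA_i=J$, $A_i^\top=A_i$, $A_iA_j=\sum_h p_{ij}^hA_h$; $A_1,\dots,A_d$ are the non-trivial relations, each regarded as the adjacency matrix of a graph on $X$. $\mathcal{R}$ is amorphic if for every partition of $\{0,\dots,d\}$ having $\{0\}$ as a part, the sums of the $A_l$ over the parts form an association scheme. A strongly regular graph on $v$ vertices with valency $k$ is of Latin square type if $v=n^2$, $k=t(n-1)$ and its restricted eigenvalues (eigenvalues on eigenvectors orthogonal to the all-ones vector) are $n-t$ and $-t$ for some positive integers $n,t$; it is of negative Latin square type if the same holds with $n,t$ negative integers. -}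

module Defs where

open import Data.Nat using (ℕ; suc)
open import Data.Fin using (Fin; zero; _≟_)
open import Data.Fin.Properties using () renaming (_≟_ to _≟F_)
open import Data.List using (List; length; filter; map; foldr; allFin)
open import Data.Integer as ℤ using (ℤ; +_; _*_; _-_; -_; _>_)
open import Data.Product using (Σ; ∃; _×_; _,_)
open import Data.Sum using (_⊎_)
open import Relation.Nullary using (¬_; Dec; yes; no)
open import Relation.Nullary.Decidable using (_×-dec_)
open import Relation.Binary.PropositionalEquality using (_≡_; _≢_)
open import Function.Bundles using (_⇔_)

count : (v : ℕ) {P : Fin v → Set} → ((z : Fin v) → Dec (P z)) → ℕ
count v P? = length (filter P? (allFin v))

sumℤ : (v : ℕ) → (Fin v → ℤ) → ℤ
sumℤ v u = foldr ℤ._+_ (+ 0) (map u (allFin v))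

-- A d-class scheme on X = Fin v is encoded by the function R with
-- R x y = i  iff  (A_i)_{xy} = 1.  This encodes exactly a family of
-- 01-matrices A_0,…,A_d with Σ A_i = J.
Rel : ℕ → ℕ → Set
Rel v d = Fin v → Fin v → Fin (suc d)

Mat : {v d : ℕ} → Rel v d → Fin (suc d) → Fin v → Fin v → ℤ
Mat R i x y with R x y ≟F i
... | yes _ = + 1
... | no  _ = + 0

-- Symmetric association scheme with d classes:
--  * each A_i is nonzero,
--  * A_0 = I,
--  * A_i symmetric,
--  * A_i A_j = Σ_h p_{ij}^h A_h, i.e. the (x,y)-entry of A_i A_j depends only on h = R x y.
record IsSymScheme (v d : ℕ) (R : Rel v d) : Set where
  field
    nonempty  : (i : Fin (suc d)) → ∃ λ x → ∃ λ y → R x y ≡ i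
    diagonal  : (x y : Fin v) → (R x y ≡ zero) ⇔ (x ≡ y)
    symmetric : (x y : Fin v) → R x y ≡ R y x
    intersection : (i j h : Fin (suc d)) → ∃ λ (p : ℕ) →
      (x y : Fin v) → R x y ≡ h →
      count v (λ z → (R x z ≟F i) ×-dec (R z y ≟F j)) ≡ p

-- Merging classes along a partition of {0,…,d} into e+1 parts having {0} as a part:
-- f is a surjection onto the parts with f i = 0 iff i = 0.
IsPartitionFixing0 : {d e : ℕ} → (Fin (suc d) → Fin (suc e)) → Set
IsPartitionFixing0 {d} {e} f =
  ((p : Fin (suc e)) → ∃ λ i → f i ≡ p) ×
  ((i : Fin (suc d)) → (f i ≡ zero) ⇔ (i ≡ zero))

IsAmorphic : (v d : ℕ) → Rel v d → Set
IsAmorphic v d R = (e : ℕ) (f : Fin (suc d) → Fin (suc e)) →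
  IsPartitionFixing0 f → IsSymScheme v e (λ x y → f (R x y))

IsSRG : (v d : ℕ) → Rel v d → Fin (suc d) → (k l m : ℕ) → Set
IsSRG v d R i k l m =
  ((x : Fin v) → count v (λ y → R x y ≟F i) ≡ k) ×
  ((x y : Fin v) → R x y ≡ i →
     count v (λ z → (R x z ≟F i) ×-dec (R z y ≟F i)) ≡ l) ×
  ((x y : Fin v) → x ≢ y → R x y ≢ i →
     count v (λ z → (R x z ≟F i) ×-dec (R z y ≟F i)) ≡ m)

IsRestrictedEigenvalue : (v d : ℕ) → Rel v d → Fin (suc d) → ℤ → Set
IsRestrictedEigenvalue v d R i θ = ∃ λ (u : Fin v → ℤ) →
  (∃ λ x → u x ≢ + 0) ×
  (sumℤ v u ≡ + 0) ×
  ((x : Fin v) → sumℤ v (λ y → Mat R i x y * u y) ≡ θ * u x)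

RestrictedEigenvaluesAre : (v d : ℕ) → Rel v d → Fin (suc d) → ℤ → ℤ → Set
RestrictedEigenvaluesAre v d R i θ₁ θ₂ =
  IsRestrictedEigenvalue v d R i θ₁ ×
  IsRestrictedEigenvalue v d R i θ₂ ×
  ((θ : ℤ) → IsRestrictedEigenvalue v d R i θ → (θ ≡ θ₁) ⊎ (θ ≡ θ₂))

LSParams : (v d : ℕ) → Rel v d → Fin (suc d) → ℤ → ℤ → Set
LSParams v d R i n t = ∃ λ k → ∃ λ l → ∃ λ m →
  IsSRG v d R i k l m ×
  (+ v ≡ n * n) ×
  (+ k ≡ t * (n - + 1)) ×
  RestrictedEigenvaluesAre v d R i (n - t) (- t)

IsLatinSquareType : (v d : ℕ) → Rel v d → Fin (suc d) → Set
IsLatinSquareType v d R i = ∃ λ n → ∃ λ t →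
  (n > + 0) × (t > + 0) × LSParams v d R i n t

IsNegLatinSquareType : (v d : ℕ) → Rel v d → Fin (suc d) → Set
IsNegLatinSquareType v d R i = ∃ λ n → ∃ λ t →
  (+ 0 > n) × (+ 0 > t) × LSParams v d R i n t

{-# OPTIONS --safe #-}

-- For a class A i with the signed parameters (n , t), n² = v, put G = n A i + t (n I - J): then G² = v G and
-- J G = 0, so G / v is the projection onto one eigenspace of A i.  For i ≠ j the diagonal entries of G i · G j equal
-- n i · t i · t j · (n j - n i).
-- If all n i agree, they vanish, so the symmetric multiple G i · G j of an idempotent is 0.  This gives a closed form
-- for A i · A j in terms of A i, A j, I and J that survives summation over parts; products with the part of the
-- exceptional class follow by complementation.
-- The signs can be made to agree: a class with n + 1 = 2 t also has the parameters (- n , t - n), and two classes i, j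
-- of opposite signs for which this identity fails cannot coexist.  To see this, choose X₁ = G i and for X₂ another G
-- of the same sign as i, or v I - J - G i if there is none; likewise Y₁, Y₂ for j.  Every non-exceptional A h acts on
-- the four nonzero matrices X a · Y b by scalars of the form α a + β b, hence so does every matrix of the algebra; but
-- X₁ Y₁ acts by v², 0, 0, 0.
module Submission where

open import Defs
open import Data.Nat as ℕ using (ℕ; suc)
open import Data.Fin using (Fin; zero)
open import Data.Sum using (_⊎_)
open import Relation.Nullary using (¬_)
open import Relation.Binary.PropositionalEquality using (_≡_; _≢_)

open import Data.Bool using (Bool; true; false; if_then_else_)
open import Data.Empty using (⊥; ⊥-elim)
open import Data.Fin using (suc)
open import Data.Fin.Properties using (_≟_; any?; sequence)
open import Data.Integer as ℤ using (ℤ; +_; _+_; _*_; _-_; -_; _≤_; +≤+)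
import Data.Integer.Properties as ℤₚ
open import Data.Integer.Tactic.RingSolver using (solve-∀)
open import Data.List using (length; filter; map; foldr; tabulate)
import Data.Nat.Properties as ℕₚ
open import Data.Product using (Σ; ∃; _×_; _,_; proj₁; proj₂)
open import Data.Sum using (inj₁; inj₂)
open import Effect.Monad using (RawMonad)
open import Function using (_∘_)
open import Function.Bundles using (_⇔_; Equivalence; mk⇔)
open import Relation.Nullary using (Dec; yes; no; does)
open import Relation.Nullary.Decidable using (_×-dec_; dec-true; dec-false; ¬?; ¬¬-excluded-middle; decidable-stable)
open import Relation.Nullary.Negation using (¬¬-Monad)
open import Relation.Binary.PropositionalEquality using (refl; sym; trans; cong; cong₂; subst; module ≡-Reasoning)
open import Algebra.Properties.Semiring.Sum ℤₚ.+-*-semiring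
  using (sum; sum-cong-≋; ∑-distrib-+; ∑-comm; *-distribˡ-sum; *-distribʳ-sum)
open ≡-Reasoning

-- Finite sums and matrices over ℤ

-- Reading off `does` instead of matching on the decision lets `δ (suc i) (suc j)` reduce to
-- `δ i j`, on which the recursion in `sum-δ` relies.
⟦_⟧ : {P : Set} → Dec P → ℤ
⟦ d ⟧ = if does d then + 1 else + 0

⟦⟧-true : {P : Set} (d : Dec P) → P → ⟦ d ⟧ ≡ + 1
⟦⟧-true d p = cong (if_then + 1 else + 0) (dec-true d p)

⟦⟧-false : {P : Set} (d : Dec P) → ¬ P → ⟦ d ⟧ ≡ + 0
⟦⟧-false d ¬p = cong (if_then + 1 else + 0) (dec-false d ¬p)

⟦⟧-⇔ : {P Q : Set} (d : Dec P) (e : Dec Q) → (P → Q) → (Q → P) → ⟦ d ⟧ ≡ ⟦ e ⟧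
⟦⟧-⇔ d (yes q) _ g = ⟦⟧-true d (g q)
⟦⟧-⇔ d (no ¬q) f _ = ⟦⟧-false d (¬q ∘ f)

⟦⟧-× : {P Q : Set} (d : Dec P) (e : Dec Q) → ⟦ d ×-dec e ⟧ ≡ ⟦ d ⟧ * ⟦ e ⟧
⟦⟧-× (yes _) (yes _) = refl
⟦⟧-× (yes _) (no _)  = refl
⟦⟧-× (no _)  (yes _) = refl
⟦⟧-× (no _)  (no _)  = refl

⟦⟧-nonneg : {P : Set} (d : Dec P) → + 0 ≤ ⟦ d ⟧
⟦⟧-nonneg (yes _) = +≤+ ℕ.z≤n
⟦⟧-nonneg (no _)  = ℤₚ.≤-refl

δ : ∀ {n} → Fin n → Fin n → ℤ
δ i j = ⟦ i ≟ j ⟧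

sum-cong : ∀ {n} {f g : Fin n → ℤ} → (∀ i → f i ≡ g i) → sum f ≡ sum g
sum-cong = sum-cong-≋

sum-zero : ∀ n → sum {n} (λ _ → + 0) ≡ + 0
sum-zero ℕ.zero  = refl
sum-zero (suc n) = trans (ℤₚ.+-identityˡ _) (sum-zero n)

sum-δ : ∀ {n} (i : Fin n) (f : Fin n → ℤ) → sum (λ j → δ i j * f j) ≡ f i
sum-δ {suc n} zero f = trans (cong₂ _+_ (ℤₚ.*-identityˡ (f zero)) (sum-zero n)) (ℤₚ.+-identityʳ _)
sum-δ (suc i) f = trans (ℤₚ.+-identityˡ _) (sum-δ i (f ∘ suc))

sum-one : ∀ n → sum {n} (λ _ → + 1) ≡ + n
sum-one ℕ.zero = refl
sum-one (suc n) = cong (_+_ (+ 1)) (sum-one n)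

sum-*ˡ : ∀ {n} c (f : Fin n → ℤ) → sum (λ i → c * f i) ≡ c * sum f
sum-*ˡ c f = sym (*-distribˡ-sum c f)

sum-≥0 : ∀ {n} {f : Fin n → ℤ} → (∀ i → + 0 ≤ f i) → + 0 ≤ sum f
sum-≥0 {ℕ.zero} _ = ℤₚ.≤-refl
sum-≥0 {suc n} f≥0 = ℤₚ.+-mono-≤ (f≥0 zero) (sum-≥0 (f≥0 ∘ suc))

+-≡0 : ∀ {a b} → + 0 ≤ a → + 0 ≤ b → a + b ≡ + 0 → a ≡ + 0 × b ≡ + 0
+-≡0 {+ ℕ.zero} {+ ℕ.zero} _ _ _ = refl , refl
+-≡0 {+ ℕ.zero} {+ suc _} _ _ ()
+-≡0 {+ suc _} {+ _} _ _ ()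

sum-≡0 : ∀ {n} {f : Fin n → ℤ} → (∀ i → + 0 ≤ f i) → sum f ≡ + 0 → ∀ i → f i ≡ + 0
sum-≡0 f≥0 eq zero = proj₁ (+-≡0 (f≥0 zero) (sum-≥0 (f≥0 ∘ suc)) eq)
sum-≡0 f≥0 eq (suc i) =
  sum-≡0 (f≥0 ∘ suc) (proj₂ (+-≡0 (f≥0 zero) (sum-≥0 (f≥0 ∘ suc)) eq)) i

-- In the sum of the differences every term but the `k`-th vanishes. This later recovers a product
-- with the part of the exceptional class from the products with all other parts.
sum-determines : ∀ {n} (k : Fin n) {f g : Fin n → ℤ} → sum f ≡ sum g →
  (∀ i → i ≢ k → f i ≡ g i) → f k ≡ g k
sum-determines k {f} {g} eq rest = ℤₚ.i-j≡0⇒i≡j _ _ (begin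
  f k - g k                            ≡⟨ sum-δ k (λ i → f i - g i) ⟨
  sum (λ i → δ k i * (f i - g i))      ≡⟨ sum-cong off ⟩
  sum (λ i → f i + (- + 1) * g i)          ≡⟨ ∑-distrib-+ f _ ⟩
  sum f + sum (λ i → (- + 1) * g i)        ≡⟨ cong (_+_ (sum f)) (sum-*ˡ (- + 1) g) ⟩
  sum f + (- + 1) * sum g              ≡⟨ cong (λ s → s + (- + 1) * sum g) eq ⟩
  sum g + (- + 1) * sum g              ≡⟨ cancel (sum g) ⟩
  + 0                                  ∎)
  where
  cancel : ∀ a → a + (- + 1) * a ≡ + 0
  cancel = solve-∀
  ring₁ : ∀ a b → + 1 * (a - b) ≡ a + (- + 1) * b
  ring₁ = solve-∀
  off : ∀ i → δ k i * (f i - g i) ≡ f i + (- + 1) * g i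
  off i with k ≟ i
  ... | yes _  = ring₁ (f i) (g i)
  ... | no k≢i = sym (trans (cong (λ s → s + (- + 1) * g i) (rest i (k≢i ∘ sym))) (cancel (g i)))

square-≥0 : ∀ a → + 0 ≤ a * a
square-≥0 (+ n)      = subst (+ 0 ≤_) (ℤₚ.pos-* n n) (+≤+ ℕ.z≤n)
square-≥0 ℤ.-[1+ n ] = +≤+ ℕ.z≤n

count-sum : ∀ v {P : Fin v → Set} (P? : ∀ z → Dec (P z)) → + count v P? ≡ sum (λ z → ⟦ P? z ⟧)
-- `allFin v` is `tabulate` of the identity; the induction runs over an arbitrary `g` because the
-- tail tabulates `g ∘ suc`.
count-sum v {P} P? = go (λ z → z)
  where
  go : ∀ {m} (g : Fin m → Fin v) → + length (filter P? (tabulate g)) ≡ sum (λ z → ⟦ P? (g z) ⟧)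
  go {ℕ.zero} g = refl
  go {suc m} g with P? (g zero)
  ... | yes _ = cong (_+_ (+ 1)) (go (g ∘ suc))
  ... | no  _ = trans (go (g ∘ suc)) (sym (ℤₚ.+-identityˡ _))

sumℤ-sum : ∀ v (u : Fin v → ℤ) → sumℤ v u ≡ sum u
sumℤ-sum v u = go (λ z → z)
  where
  go : ∀ {m} (g : Fin m → Fin v) → foldr _+_ (+ 0) (map u (tabulate g)) ≡ sum (u ∘ g)
  go {ℕ.zero} g = refl
  go {suc m} g = cong (_+_ (u (g zero))) (go (g ∘ suc))

Matrix : ℕ → Set
Matrix v = Fin v → Fin v → ℤ

infixl 7 _·_

_·_ : ∀ {v} → Matrix v → Matrix v → Matrix v
(M · N) x y = sum (λ z → M x z * N z y)

module _ {v : ℕ} where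

  ·-cong : {M M′ N N′ : Matrix v} → (∀ x y → M x y ≡ M′ x y) → (∀ x y → N x y ≡ N′ x y) →
    ∀ x y → (M · N) x y ≡ (M′ · N′) x y
  ·-cong p q x y = sum-cong (λ z → cong₂ _*_ (p x z) (q z y))

  ·-assoc : (M N K : Matrix v) → ∀ x y → (M · N · K) x y ≡ (M · (N · K)) x y
  ·-assoc M N K x y = begin
    sum (λ z → sum (λ w → M x w * N w z) * K z y)
      ≡⟨ sum-cong (λ z → *-distribʳ-sum (K z y) (λ w → M x w * N w z)) ⟩
    sum (λ z → sum (λ w → M x w * N w z * K z y))
      ≡⟨ ∑-comm (λ z w → M x w * N w z * K z y) ⟩
    sum (λ w → sum (λ z → M x w * N w z * K z y))
      ≡⟨ sum-cong (λ w → trans (sum-cong (λ z → ℤₚ.*-assoc (M x w) (N w z) (K z y)))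
                               (sum-*ˡ (M x w) (λ z → N w z * K z y))) ⟩
    sum (λ w → M x w * sum (λ z → N w z * K z y)) ∎

  module _ {k} (c : Fin k → ℤ) (B : Fin k → Matrix v) where

    combination-·ˡ : {M : Matrix v} → (∀ x y → M x y ≡ sum (λ i → c i * B i x y)) →
      ∀ N x y → (M · N) x y ≡ sum (λ i → c i * (B i · N) x y)
    combination-·ˡ {M} eq N x y = begin
      sum (λ z → M x z * N z y)
        ≡⟨ sum-cong (λ z → trans (cong (_* N z y) (eq x z)) (*-distribʳ-sum (N z y) (λ i → c i * B i x z))) ⟩
      sum (λ z → sum (λ i → c i * B i x z * N z y))
        ≡⟨ ∑-comm (λ z i → c i * B i x z * N z y) ⟩
      sum (λ i → sum (λ z → c i * B i x z * N z y))
        ≡⟨ sum-cong (λ i → trans (sum-cong (λ z → ℤₚ.*-assoc (c i) (B i x z) (N z y)))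
                                 (sum-*ˡ (c i) (λ z → B i x z * N z y))) ⟩
      sum (λ i → c i * (B i · N) x y) ∎

    combination-·ʳ : {M : Matrix v} → (∀ x y → M x y ≡ sum (λ i → c i * B i x y)) →
      ∀ N x y → (N · M) x y ≡ sum (λ i → c i * (N · B i) x y)
    combination-·ʳ {M} eq N x y = begin
      sum (λ z → N x z * M z y)
        ≡⟨ sum-cong (λ z → trans (cong (N x z *_) (eq z y)) (*-distribˡ-sum (N x z) (λ i → c i * B i z y))) ⟩
      sum (λ z → sum (λ i → N x z * (c i * B i z y)))
        ≡⟨ ∑-comm (λ z i → N x z * (c i * B i z y)) ⟩
      sum (λ i → sum (λ z → N x z * (c i * B i z y)))
        ≡⟨ sum-cong (λ i → trans (sum-cong (λ z → swap (N x z) (c i) (B i z y)))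
                                 (sum-*ˡ (c i) (λ z → N x z * B i z y))) ⟩
      sum (λ i → c i * (N · B i) x y) ∎
      where
      swap : ∀ a b c → a * (b * c) ≡ b * (a * c)
      swap = solve-∀

≢0-*ˡ : ∀ a {b} → a ≢ + 0 → a * b ≡ + 0 → b ≡ + 0
≢0-*ˡ a a≢0 eq with ℤₚ.i*j≡0⇒i≡0∨j≡0 a eq
... | inj₁ a≡0 = ⊥-elim (a≢0 a≡0)
... | inj₂ b≡0 = b≡0

*-≢0 : ∀ {a b} → a ≢ + 0 → b ≢ + 0 → a * b ≢ + 0
*-≢0 {a} a≢0 b≢0 eq = b≢0 (≢0-*ˡ a a≢0 eq)

col : ∀ {v} → Matrix v → Fin v → ℤ
col M y = sum (λ z → M z y)

-- In matrix terms `J M = 0`: the columns are orthogonal to the all-ones vector.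
Null : ∀ {v} → Matrix v → Set
Null M = ∀ y → col M y ≡ + 0

-- The matrix `a M + b I + c J`. Its last term disappears in a product with a `Null` matrix on the
-- right.
aff : ∀ {v} → ℤ → Matrix v → ℤ → ℤ → Matrix v
aff a M b c x y = a * M x y + b * δ x y + c

module _ {v : ℕ} (a : ℤ) (M : Matrix v) (b c : ℤ) where

  aff-· : ∀ X x y → (aff a M b c · X) x y ≡ a * (M · X) x y + b * X x y + c * col X y
  aff-· X x y = begin
    sum (λ z → aff a M b c x z * X z y)
      ≡⟨ sum-cong (λ z → distribute a (M x z) b (δ x z) c (X z y)) ⟩
    sum (λ z → a * (M x z * X z y) + b * (δ x z * X z y) + c * X z y)
      ≡⟨ ∑-distrib-+ (λ z → a * (M x z * X z y) + b * (δ x z * X z y)) _ ⟩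
    sum (λ z → a * (M x z * X z y) + b * (δ x z * X z y)) + sum (λ z → c * X z y)
      ≡⟨ cong₂ _+_ (∑-distrib-+ (λ z → a * (M x z * X z y)) _) (sum-*ˡ c (λ z → X z y)) ⟩
    sum (λ z → a * (M x z * X z y)) + sum (λ z → b * (δ x z * X z y)) + c * col X y
      ≡⟨ cong (λ s → s + c * col X y)
           (cong₂ _+_ (sum-*ˡ a (λ z → M x z * X z y))
                      (trans (sum-*ˡ b (λ z → δ x z * X z y)) (cong (b *_) (sum-δ x (λ z → X z y))))) ⟩
    a * (M · X) x y + b * X x y + c * col X y ∎
    where
    distribute : ∀ a m b e c x → (a * m + b * e + c) * x ≡ a * (m * x) + b * (e * x) + c * x
    distribute = solve-∀

δ-comm : ∀ {n} (i j : Fin n) → δ i j ≡ δ j i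
δ-comm i j = ⟦⟧-⇔ (i ≟ j) (j ≟ i) sym sym

δ-refl : ∀ {n} (i : Fin n) → δ i i ≡ + 1
δ-refl i = ⟦⟧-true (i ≟ i) refl

δ-≢ : ∀ {n} {i j : Fin n} → i ≢ j → δ i j ≡ + 0
δ-≢ {i = i} {j} = ⟦⟧-false (i ≟ j)

col-aff : ∀ {v} (a : ℤ) (M : Matrix v) (b c : ℤ) y → col (aff a M b c) y ≡ a * col M y + b + c * + v
col-aff {v} a M b c y = begin
  sum (λ z → a * M z y + b * δ z y + c)
    ≡⟨ sum-cong (λ z → cong (λ e → a * M z y + e + c) (trans (cong (b *_) (δ-comm z y)) (ℤₚ.*-comm b (δ y z)))) ⟩
  sum (λ z → a * M z y + δ y z * b + c)
    ≡⟨ ∑-distrib-+ (λ z → a * M z y + δ y z * b) _ ⟩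
  sum (λ z → a * M z y + δ y z * b) + sum {v} (λ _ → c)
    ≡⟨ cong₂ _+_ (∑-distrib-+ (λ z → a * M z y) _)
         (trans (sum-cong {v} {λ _ → c} (λ _ → sym (ℤₚ.*-identityʳ c)))
                (trans (sum-*ˡ {v} c (λ _ → + 1)) (cong (c *_) (sum-one v)))) ⟩
  sum (λ z → a * M z y) + sum (λ z → δ y z * b) + c * + v
    ≡⟨ cong (λ s → s + c * + v) (cong₂ _+_ (sum-*ˡ a (λ z → M z y)) (sum-δ y (λ _ → b))) ⟩
  a * col M y + b + c * + v ∎

inhabited⇒≢0 : ∀ {n} → Fin n → + n ≢ + 0
inhabited⇒≢0 {suc _} _ ()

*-≥0 : ∀ {a b} → + 0 ≤ a → + 0 ≤ b → + 0 ≤ a * b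
*-≥0 {+ m} {+ n} _ _ = subst (+ 0 ≤_) (ℤₚ.pos-* m n) (+≤+ ℕ.z≤n)

inhabited⇒-1≥0 : ∀ {n} → Fin n → + 0 ≤ + n - + 1
inhabited⇒-1≥0 {suc _} _ = +≤+ ℕ.z≤n

*-cancelʳ : ∀ {a b} c → c ≢ + 0 → a * c ≡ b * c → a ≡ b
*-cancelʳ {a} {b} c c≢0 eq = ℤₚ.i-j≡0⇒i≡j a b (≢0-*ˡ c c≢0 (begin
  c * (a - b)   ≡⟨ ring₁ a b c ⟩
  a * c - b * c ≡⟨ ℤₚ.i≡j⇒i-j≡0 eq ⟩
  + 0           ∎))
  where
  ring₁ : ∀ a b c → c * (a - b) ≡ a * c - b * c
  ring₁ = solve-∀

·-null : ∀ {v} {M N : Matrix v} → Null M → Null (M · N)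
·-null {v} {M} {N} null y = begin
  sum (λ z → sum (λ w → M z w * N w y)) ≡⟨ ∑-comm (λ z w → M z w * N w y) ⟩
  sum (λ w → sum (λ z → M z w * N w y)) ≡⟨ sum-cong (λ w → trans (sym (*-distribʳ-sum (N w y) (λ z → M z w))) (cong (_* N w y) (null w))) ⟩
  sum {v} (λ w → + 0)                   ≡⟨ sum-zero v ⟩
  + 0                                   ∎

-- The algebra of a scheme

module Scheme {v d : ℕ} {R : Rel v d} (scheme : IsSymScheme v d R) where

  open IsSymScheme scheme

  x₀ : Fin v
  x₀ = proj₁ (nonempty zero)

  v≢0 : + v ≢ + 0
  v≢0 = inhabited⇒≢0 x₀

  A : Fin (suc d) → Matrix v
  A i x y = δ (R x y) i

  p : (i j h : Fin (suc d)) → ℕ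
  p i j h = proj₁ (intersection i j h)

  A-zero : ∀ x y → A zero x y ≡ δ x y
  A-zero x y = ⟦⟧-⇔ (R x y ≟ zero) (x ≟ y) (Equivalence.to (diagonal x y)) (Equivalence.from (diagonal x y))

  A-diagonal : ∀ {i} → i ≢ zero → ∀ x → A i x x ≡ + 0
  A-diagonal i≢0 x = δ-≢ (λ eq → i≢0 (trans (sym eq) (Equivalence.from (diagonal x x) refl)))

  count-A·A : ∀ i j x y → + count v (λ z → (R x z ≟ i) ×-dec (R z y ≟ j)) ≡ (A i · A j) x y
  count-A·A i j x y = trans (count-sum v (λ z → (R x z ≟ i) ×-dec (R z y ≟ j)))
    (sum-cong (λ z → ⟦⟧-× (R x z ≟ i) (R z y ≟ j)))

  A·A : ∀ i j x y → (A i · A j) x y ≡ + p i j (R x y)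
  A·A i j x y = trans (sym (count-A·A i j x y))
    (cong +_ (proj₂ (intersection i j (R x y)) x y refl))

  -- Membership in the Bose-Mesner algebra over the integers; `m` lists the coefficients with
  -- respect to the `A i`.
  Measurable : Matrix v → Set
  Measurable M = Σ (Fin (suc d) → ℤ) λ m → ∀ x y → M x y ≡ m (R x y)

  expand : ∀ {M} ((m , _) : Measurable M) → ∀ x y → M x y ≡ sum (λ i → m i * A i x y)
  expand (m , M≡m) x y = trans (M≡m x y) (trans (sym (sum-δ (R x y) m))
    (sum-cong (λ i → ℤₚ.*-comm (δ (R x y) i) (m i))))

  A-measurable : ∀ i → Measurable (A i)
  A-measurable i = (λ h → δ h i) , λ _ _ → refl

  -- Both factors are expanded over the classes, and each `A i · A j` is constant on classes by the
  -- intersection numbers.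
  ·-measurable : ∀ {M N} → Measurable M → Measurable N → Measurable (M · N)
  ·-measurable {M} {N} Mm@(m , _) Nm@(n , _) = (λ h → sum (λ i → m i * sum (λ j → n j * + p i j h))) ,
    λ x y → trans (combination-·ˡ m A (expand Mm) N x y)
      (sum-cong (λ i → cong (m i *_) (trans (combination-·ʳ n A (expand Nm) (A i) x y)
        (sum-cong (λ j → cong (n j *_) (A·A i j x y))))))

  aff-measurable : ∀ {M} a b c → Measurable M → Measurable (aff a M b c)
  aff-measurable a b c (m , M≡m) = (λ h → a * m h + b * δ h zero + c) ,
    λ x y → cong₂ (λ m e → a * m + b * e + c) (M≡m x y) (sym (A-zero x y))

  measurable-sym : ∀ {M} → Measurable M → ∀ x y → M x y ≡ M y x
  measurable-sym (m , M≡m) x y = trans (M≡m x y) (trans (cong m (symmetric x y)) (sym (M≡m y x)))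

  -- The product lies in the algebra again and is therefore symmetric, while transposition exchanges
  -- the two symmetric factors.
  ·-comm : ∀ {M N} → Measurable M → Measurable N → ∀ x y → (M · N) x y ≡ (N · M) x y
  ·-comm {M} {N} Mm Nm x y = trans (measurable-sym (·-measurable Mm Nm) x y)
    (sum-cong (λ z → trans (cong₂ _*_ (measurable-sym Mm y z) (measurable-sym Nm z x))
                           (ℤₚ.*-comm (M z y) (N x z))))

  ·-left-comm : ∀ {M N} → Measurable M → Measurable N → ∀ K x y → (M · (N · K)) x y ≡ (N · (M · K)) x y
  ·-left-comm {M} {N} Mm Nm K x y = begin
    (M · (N · K)) x y ≡⟨ ·-assoc M N K x y ⟨
    (M · N · K) x y   ≡⟨ ·-cong {M = M · N} {N · M} {K} {K} (·-comm Mm Nm) (λ _ _ → refl) x y ⟩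
    (N · M · K) x y   ≡⟨ ·-assoc N M K x y ⟩
    (N · (M · K)) x y ∎

  ·-interchange : ∀ M {N K} → Measurable N → Measurable K → ∀ L x y →
    (M · N · (K · L)) x y ≡ (M · K · (N · L)) x y
  ·-interchange M {N} {K} Nm Km L x y = begin
    (M · N · (K · L)) x y   ≡⟨ ·-assoc M N (K · L) x y ⟩
    (M · (N · (K · L))) x y ≡⟨ ·-cong {M = M} {M} {N · (K · L)} {K · (N · L)} (λ _ _ → refl) (·-left-comm Nm Km L) x y ⟩
    (M · (K · (N · L))) x y ≡⟨ ·-assoc M K (N · L) x y ⟨
    (M · K · (N · L)) x y   ∎

  module _ {P : Matrix v} (Pm : Measurable P) (c : ℤ) (idem : ∀ x y → (P · P) x y ≡ c * P x y) where

    -- By symmetry of `P` the diagonal of `P · P` consists of squared row norms. Hence `c * P x x`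
    -- is nonnegative, and a zero diagonal forces every row to be zero.
    row-norm : ∀ x → sum (λ z → P x z * P x z) ≡ c * P x x
    row-norm x = trans (sum-cong (λ z → cong (P x z *_) (measurable-sym Pm x z))) (idem x x)

    idempotent-diagonal-≥0 : ∀ x → + 0 ≤ c * P x x
    idempotent-diagonal-≥0 x = subst (+ 0 ≤_) (row-norm x) (sum-≥0 (λ z → square-≥0 (P x z)))

    idempotent-zero : (∀ x → P x x ≡ + 0) → ∀ x y → P x y ≡ + 0
    idempotent-zero diag x y with ℤₚ.i*j≡0⇒i≡0∨j≡0 (P x y)
      (sum-≡0 (λ z → square-≥0 (P x z)) (trans (row-norm x) (trans (cong (c *_) (diag x)) (ℤₚ.*-zeroʳ c))) y)
    ... | inj₁ eq = eq
    ... | inj₂ eq = eq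

  -- Latin square parameters of either sign and the eigenspace projections

  record Good (i : Fin (suc d)) (n t : ℤ) : Set where
    field
      order : n * n ≡ + v
      degree : ∀ y → col (A i) y ≡ t * (n - + 1)
      -- Expanded form of `(A - (n - t) I) (A + t I) = t (t - 1) J`, which exhibits `n - t` and
      -- `- t` as the restricted eigenvalues.
      square : ∀ x y → (A i · A i) x y ≡ t * (t - + 1) + (n - + 2 * t) * A i x y + t * (n - t) * δ x y

    n≢0 : n ≢ + 0
    n≢0 n≡0 = v≢0 (trans (sym order) (cong (_* n) n≡0))

    -- Orthogonally to the all-ones vector this is `n (A i + t I)`, which is `0` on the eigenspace
    -- of `- t` and `n * n` on that of `n - t`. The multiple of `J` is chosen to kill the all-ones
    -- vector.
    G : Matrix v
    G = aff n (A i) (t * n) (- t)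

    G-measurable : Measurable G
    G-measurable = aff-measurable n (t * n) (- t) (A-measurable i)

    G-null : Null G
    G-null y = begin
      col G y                                    ≡⟨ col-aff n (A i) (t * n) (- t) y ⟩
      n * col (A i) y + t * n + - t * + v        ≡⟨ cong₂ (λ k w → n * k + t * n + - t * w) (degree y) (sym order) ⟩
      n * (t * (n - + 1)) + t * n + - t * (n * n) ≡⟨ vanish n t ⟩
      + 0                                        ∎
      where
      vanish : ∀ n t → n * (t * (n - + 1)) + t * n + - t * (n * n) ≡ + 0
      vanish = solve-∀

    G-· : ∀ {X} → Null X → ∀ x y → (G · X) x y ≡ n * (A i · X) x y + t * n * X x y
    G-· {X} null x y = begin
      (G · X) x y                                               ≡⟨ aff-· n (A i) (t * n) (- t) X x y ⟩
      n * (A i · X) x y + t * n * X x y + - t * col X y ≡⟨ cong (λ s → n * (A i · X) x y + t * n * X x y + - t * s) (null y) ⟩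
      n * (A i · X) x y + t * n * X x y + - t * + 0     ≡⟨ drop (n * (A i · X) x y + t * n * X x y) t ⟩
      n * (A i · X) x y + t * n * X x y                 ∎
      where
      drop : ∀ a t → a + - t * + 0 ≡ a
      drop = solve-∀

    A-eigen : ∀ x y → (A i · G) x y ≡ (n - t) * G x y
    A-eigen x y = begin
      (A i · G) x y ≡⟨ ·-comm (A-measurable i) G-measurable x y ⟩
      (G · A i) x y ≡⟨ aff-· n (A i) (t * n) (- t) (A i) x y ⟩
      n * (A i · A i) x y + t * n * A i x y + - t * col (A i) y
        ≡⟨ cong₂ (λ s k → n * s + t * n * A i x y + - t * k) (square x y) (degree y) ⟩
      n * (t * (t - + 1) + (n - + 2 * t) * A i x y + t * (n - t) * δ x y) + t * n * A i x y + - t * (t * (n - + 1))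
        ≡⟨ ring₁ n t (A i x y) (δ x y) ⟩
      (n - t) * G x y ∎
      where
      ring₁ : ∀ n t a e → n * (t * (t - + 1) + (n - + 2 * t) * a + t * (n - t) * e) + t * n * a + - t * (t * (n - + 1))
        ≡ (n - t) * (n * a + t * n * e + - t)
      ring₁ = solve-∀

    G-idempotent : ∀ x y → (G · G) x y ≡ + v * G x y
    G-idempotent x y = begin
      (G · G) x y ≡⟨ G-· G-null x y ⟩
      n * (A i · G) x y + t * n * G x y ≡⟨ cong (λ s → n * s + t * n * G x y) (A-eigen x y) ⟩
      n * ((n - t) * G x y) + t * n * G x y ≡⟨ ring₁ n t (G x y) ⟩
      n * n * G x y ≡⟨ cong (_* G x y) order ⟩
      + v * G x y ∎
      where
      ring₁ : ∀ n t g → n * ((n - t) * g) + t * n * g ≡ n * n * g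
      ring₁ = solve-∀

    -- On a `Null` matrix `G` acts as `n (A i + t I)`, and the nonzero `n` can be cancelled.
    A-eigen-annihilated : ∀ {X} → Null X → (∀ x y → (G · X) x y ≡ + 0) → ∀ x y → (A i · X) x y ≡ - t * X x y
    A-eigen-annihilated {X} null GX≡0 x y = ℤₚ.i-j≡0⇒i≡j _ _ (≢0-*ˡ n n≢0 (begin
      n * ((A i · X) x y - - t * X x y)   ≡⟨ ring₁ n t ((A i · X) x y) (X x y) ⟩
      n * (A i · X) x y + t * n * X x y   ≡⟨ G-· null x y ⟨
      (G · X) x y                         ≡⟨ GX≡0 x y ⟩
      + 0                                 ∎))
      where
      ring₁ : ∀ n t a g → n * (a - - t * g) ≡ n * a + t * n * g
      ring₁ = solve-∀

    -- This is `v I - J - G`, that is, `v` times the projection onto the eigenspace of `- t`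
    -- orthogonal to the all-ones vector.
    C : Matrix v
    C = aff (- + 1) G (+ v) (- + 1)

    C-measurable : Measurable C
    C-measurable = aff-measurable (- + 1) (+ v) (- + 1) G-measurable

    C-null : Null C
    C-null y = begin
      col C y                                  ≡⟨ col-aff (- + 1) G (+ v) (- + 1) y ⟩
      - + 1 * col G y + + v + - + 1 * + v      ≡⟨ cong (λ k → - + 1 * k + + v + - + 1 * + v) (G-null y) ⟩
      - + 1 * + 0 + + v + - + 1 * + v          ≡⟨ ring₁ (+ v) ⟩
      + 0                                      ∎
      where
      ring₁ : ∀ w → - + 1 * + 0 + w + - + 1 * w ≡ + 0
      ring₁ = solve-∀

    C-· : ∀ {X} → Null X → ∀ x y → (C · X) x y ≡ + v * X x y - (G · X) x y
    C-· {X} null x y = begin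
      (C · X) x y                                              ≡⟨ aff-· (- + 1) G (+ v) (- + 1) X x y ⟩
      - + 1 * (G · X) x y + + v * X x y + - + 1 * col X y      ≡⟨ cong (λ s → - + 1 * (G · X) x y + + v * X x y + - + 1 * s) (null y) ⟩
      - + 1 * (G · X) x y + + v * X x y + - + 1 * + 0          ≡⟨ ring₁ ((G · X) x y) (+ v * X x y) ⟩
      + v * X x y - (G · X) x y                                ∎
      where
      ring₁ : ∀ g b → - + 1 * g + b + - + 1 * + 0 ≡ b - g
      ring₁ = solve-∀

    G·C≡0 : ∀ x y → (G · C) x y ≡ + 0
    G·C≡0 x y = begin
      (G · C) x y               ≡⟨ ·-comm G-measurable C-measurable x y ⟩
      (C · G) x y               ≡⟨ C-· G-null x y ⟩
      + v * G x y - (G · G) x y ≡⟨ ℤₚ.i≡j⇒i-j≡0 (sym (G-idempotent x y)) ⟩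
      + 0                       ∎

    C-idempotent : ∀ x y → (C · C) x y ≡ + v * C x y
    C-idempotent x y = begin
      (C · C) x y               ≡⟨ C-· C-null x y ⟩
      + v * C x y - (G · C) x y ≡⟨ cong (λ s → + v * C x y - s) (G·C≡0 x y) ⟩
      + v * C x y - + 0         ≡⟨ ℤₚ.+-identityʳ (+ v * C x y) ⟩
      + v * C x y               ∎

    module _ (i≢0 : i ≢ zero) where

      G-diagonal : ∀ x → G x x ≡ t * (n - + 1)
      G-diagonal x = trans (cong₂ (λ a e → n * a + t * n * e + - t) (A-diagonal i≢0 x) (δ-refl x)) (ring₁ n t)
        where
        ring₁ : ∀ n t → n * + 0 + t * n * + 1 + - t ≡ t * (n - + 1)
        ring₁ = solve-∀

      -- Some pair lies in class `i`, so a column of nonnegative entries contains a `1`.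
      degree≢0 : t * (n - + 1) ≢ + 0
      degree≢0 eq with nonempty i
      ... | x , y , Rxy≡i = 1≢0 (trans (sym (trans (cong (λ h → δ h i) Rxy≡i) (δ-refl i)))
          (sum-≡0 (λ z → ⟦⟧-nonneg (R z y ≟ i)) (trans (degree y) eq) x))
        where
        1≢0 : + 1 ≢ + 0
        1≢0 ()

      C-diagonal : ∀ x → C x x ≡ + v - + 1 - t * (n - + 1)
      C-diagonal x = trans (cong₂ (λ g e → - + 1 * g + + v * e + - + 1) (G-diagonal x) (δ-refl x)) (ring₁ (t * (n - + 1)) (+ v))
        where
        ring₁ : ∀ g w → - + 1 * g + w * + 1 + - + 1 ≡ w - + 1 - g
        ring₁ = solve-∀

      t≢0 : t ≢ + 0
      t≢0 t≡0 = degree≢0 (cong (_* (n - + 1)) t≡0)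

      n-1≢0 : n - + 1 ≢ + 0
      n-1≢0 eq = degree≢0 (trans (cong (t *_) eq) (ℤₚ.*-zeroʳ t))

  module _ {i j n m t s} (gi : Good i n t) (gj : Good j m s) (i≢0 : i ≢ zero) (j≢0 : j ≢ zero) (i≢j : i ≢ j) where
    private
      module Gi = Good gi
      module Gj = Good gj

    A·A-diagonal : ∀ x → (A j · A i) x x ≡ + 0
    A·A-diagonal x = trans (sum-cong term) (sum-zero v)
      where
      term : ∀ z → A j x z * A i z x ≡ + 0
      term z with R x z ≟ j
      ... | no  _  = refl
      ... | yes eq = trans (cong (+ 1 *_) (δ-≢ λ eq′ → i≢j (trans (sym eq′) (trans (symmetric z x) eq)))) refl

    -- Distinct classes have disjoint supports, so `A j · A i` has zero diagonal and only the
    -- degrees contribute.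
    G·G-diagonal : ∀ x → (Gi.G · Gj.G) x x ≡ n * t * s * (m - n)
    G·G-diagonal x = begin
      (Gi.G · Gj.G) x x ≡⟨ Gi.G-· Gj.G-null x x ⟩
      n * (A i · Gj.G) x x + t * n * Gj.G x x
        ≡⟨ cong₂ (λ a b → n * a + t * n * b) inner (Gj.G-diagonal j≢0 x) ⟩
      n * (m * + 0 + s * m * + 0 + - s * (t * (n - + 1))) + t * n * (s * (m - + 1))
        ≡⟨ ring₁ n m t s ⟩
      n * t * s * (m - n) ∎
      where
      inner : (A i · Gj.G) x x ≡ m * + 0 + s * m * + 0 + - s * (t * (n - + 1))
      inner = begin
        (A i · Gj.G) x x ≡⟨ ·-comm (A-measurable i) Gj.G-measurable x x ⟩
        (Gj.G · A i) x x ≡⟨ aff-· m (A j) (s * m) (- s) (A i) x x ⟩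
        m * (A j · A i) x x + s * m * A i x x + - s * col (A i) x
          ≡⟨ cong₂ (λ a b → m * a + s * m * b + - s * col (A i) x) (A·A-diagonal x) (A-diagonal i≢0 x) ⟩
        m * + 0 + s * m * + 0 + - s * col (A i) x
          ≡⟨ cong (λ a → m * + 0 + s * m * + 0 + - s * a) (Gi.degree x) ⟩
        m * + 0 + s * m * + 0 + - s * (t * (n - + 1)) ∎
      ring₁ : ∀ n m t s → n * (m * + 0 + s * m * + 0 + - s * (t * (n - + 1))) + t * n * (s * (m - + 1))
        ≡ n * t * s * (m - n)
      ring₁ = solve-∀

  idempotent-· : ∀ {P Q} → Measurable P → Measurable Q → (∀ x y → (P · P) x y ≡ + v * P x y) →
    (∀ x y → (Q · Q) x y ≡ + v * Q x y) → ∀ x y → (P · Q · (P · Q)) x y ≡ + v * + v * (P · Q) x y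
  idempotent-· {P} {Q} Pm Qm P-idem Q-idem x y = begin
    (P · Q · (P · Q)) x y ≡⟨ ·-interchange P Qm Pm Q x y ⟩
    (P · P · (Q · Q)) x y ≡⟨ sum-cong (λ z → trans (cong₂ _*_ (P-idem x z) (Q-idem z y)) (ring₁ (+ v) (P x z) (Q z y))) ⟩
    sum (λ z → + v * + v * (P x z * Q z y)) ≡⟨ sum-*ˡ (+ v * + v) (λ z → P x z * Q z y) ⟩
    + v * + v * (P · Q) x y ∎
    where
    ring₁ : ∀ w p q → w * p * (w * q) ≡ w * w * (p * q)
    ring₁ = solve-∀

  module _ {i j n t s} (gi : Good i n t) (gj : Good j n s) (i≢0 : i ≢ zero) (j≢0 : j ≢ zero) (i≢j : i ≢ j) where
    private
      module Gi = Good gi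
      module Gj = Good gj

    -- With equal orders the factor `m - n` in `G·G-diagonal` vanishes, and `idempotent-zero`
    -- applies to the product.
    G-orthogonal : ∀ x y → (Gi.G · Gj.G) x y ≡ + 0
    G-orthogonal = idempotent-zero (·-measurable Gi.G-measurable Gj.G-measurable) (+ v * + v)
      (idempotent-· Gi.G-measurable Gj.G-measurable Gi.G-idempotent Gj.G-idempotent)
      (λ x → trans (G·G-diagonal gi gj i≢0 j≢0 i≢j x) (ring₁ n t s))
      where
      ring₁ : ∀ n t s → n * t * s * (n - n) ≡ + 0
      ring₁ = solve-∀

-- Classes of opposite signs

module Mixed {v d : ℕ} {R : Rel v d} (scheme : IsSymScheme v d R) where

  open IsSymScheme scheme
  open Scheme scheme

  -- One side of the two by two grid of blocks `X a · Y b`: `X true` and `X false` play the roles of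
  -- X₁ and X₂.
  record Pair : Set where
    field
      X : Bool → Matrix v
      measurable : ∀ a → Measurable (X a)
      null : ∀ a → Null (X a)
      idempotent : ∀ x y → (X true · X true) x y ≡ + v * X true x y
      orthogonal : ∀ x y → (X true · X false) x y ≡ + 0

  Eigen : Pair → Fin (suc d) → Set
  Eigen P h = Σ (Bool → ℤ) λ α → ∀ a x y → (A h · X a) x y ≡ α a * X a x y
    where open Pair P

  module _ (P Q : Pair) (e : Fin (suc d)) where
    open Pair P
    open Pair Q renaming (X to Y; measurable to Y-measurable; null to Y-null;
                          idempotent to Y-idempotent; orthogonal to Y-orthogonal)

    -- Such eigenvalues on the grid have alternating sum zero, and their form is preserved by linear
    -- combinations of the acting matrices.
    Additive : Fin (suc d) → Set
    Additive h = Σ (Bool → ℤ) λ α → Σ (Bool → ℤ) λ β →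
      ∀ a b x y → (A h · (X a · Y b)) x y ≡ (α a + β b) * (X a · Y b) x y

    -- A class acting by scalars on one side can be moved past the other factor by commutativity;
    -- the other side then contributes zero to the eigenvalue.
    eigen⇒additive : ∀ {h} → Eigen P h ⊎ Eigen Q h → Additive h
    eigen⇒additive {h} (inj₁ (α , eig)) = α , (λ _ → + 0) , λ a b x y → begin
      (A h · (X a · Y b)) x y ≡⟨ ·-assoc (A h) (X a) (Y b) x y ⟨
      (A h · X a · Y b) x y   ≡⟨ sum-cong (λ z → trans (cong (_* Y b z y) (eig a x z)) (ring₁ (α a) (X a x z) (Y b z y))) ⟩
      sum (λ z → (α a + + 0) * (X a x z * Y b z y)) ≡⟨ sum-*ˡ (α a + + 0) (λ z → X a x z * Y b z y) ⟩
      (α a + + 0) * (X a · Y b) x y ∎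
      where
      ring₁ : ∀ a x y → a * x * y ≡ (a + + 0) * (x * y)
      ring₁ = solve-∀
    eigen⇒additive {h} (inj₂ (β , eig)) = (λ _ → + 0) , β , λ a b x y → begin
      (A h · (X a · Y b)) x y ≡⟨ ·-left-comm (A-measurable h) (measurable a) (Y b) x y ⟩
      (X a · (A h · Y b)) x y ≡⟨ sum-cong (λ z → trans (cong (X a x z *_) (eig b z y)) (ring₁ (β b) (X a x z) (Y b z y))) ⟩
      sum (λ z → (+ 0 + β b) * (X a x z * Y b z y)) ≡⟨ sum-*ˡ (+ 0 + β b) (λ z → X a x z * Y b z y) ⟩
      (+ 0 + β b) * (X a · Y b) x y ∎
      where
      ring₁ : ∀ b x y → x * (b * y) ≡ (+ 0 + b) * (x * y)
      ring₁ = solve-∀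

    module _ (additive : ∀ h → h ≢ e → Additive h) where

      αβ : ∀ h → Σ (Bool → ℤ) λ α → Σ (Bool → ℤ) λ β →
        h ≢ e → ∀ a b x y → (A h · (X a · Y b)) x y ≡ (α a + β b) * (X a · Y b) x y
      αβ h with h ≟ e
      -- Placeholders: below, the coefficient of `A e` is made zero before these values are used.
      ... | yes h≡e = (λ _ → + 0) , (λ _ → + 0) , λ h≢e → ⊥-elim (h≢e h≡e)
      ... | no h≢e with additive h h≢e
      ...   | α , β , eig = α , β , λ _ → eig

      -- Since X a · Y b has zero column sums, M may be replaced by M - m(e) J, which does not involve A e.
      measurable⇒additive : ∀ {M} → Measurable M → Σ (Bool → ℤ) λ α → Σ (Bool → ℤ) λ β →
        ∀ a b x y → (M · (X a · Y b)) x y ≡ (α a + β b) * (X a · Y b) x y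
      measurable⇒additive {M} Mm@(m , _) =
        (λ a → sum (λ h → m′ h * proj₁ (αβ h) a)) , (λ b → sum (λ h → m′ h * proj₁ (proj₂ (αβ h)) b)) , eig
        where
        M′ : Matrix v
        M′ = aff (+ 1) M (+ 0) (- m e)
        M′m : Measurable M′
        M′m = aff-measurable (+ 1) (+ 0) (- m e) Mm
        m′ : Fin (suc d) → ℤ
        m′ = proj₁ M′m
        m′e≡0 : m′ e ≡ + 0
        m′e≡0 = ring₁ (m e) (δ e zero)
          where
          ring₁ : ∀ a b → + 1 * a + + 0 * b + - a ≡ + 0
          ring₁ = solve-∀
        eig : ∀ a b x y → (M · (X a · Y b)) x y ≡
          (sum (λ h → m′ h * proj₁ (αβ h) a) + sum (λ h → m′ h * proj₁ (proj₂ (αβ h)) b)) * (X a · Y b) x y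
        eig a b x y = begin
          (M · Z) x y ≡⟨ ring₁ ((M · Z) x y) (Z x y) (m e) ⟩
          + 1 * (M · Z) x y + + 0 * Z x y + - m e * + 0
            ≡⟨ cong (λ s → + 1 * (M · Z) x y + + 0 * Z x y + - m e * s) (·-null {M = X a} {Y b} (null a) y) ⟨
          + 1 * (M · Z) x y + + 0 * Z x y + - m e * col Z y ≡⟨ aff-· (+ 1) M (+ 0) (- m e) Z x y ⟨
          (M′ · Z) x y ≡⟨ combination-·ˡ m′ A (expand M′m) Z x y ⟩
          sum (λ h → m′ h * (A h · Z) x y) ≡⟨ sum-cong (λ h → term h (h ≟ e)) ⟩
          sum (λ h → (m′ h * α h + m′ h * β h) * Z x y) ≡⟨ *-distribʳ-sum (Z x y) (λ h → m′ h * α h + m′ h * β h) ⟨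
          sum (λ h → m′ h * α h + m′ h * β h) * Z x y ≡⟨ cong (_* Z x y) (∑-distrib-+ (λ h → m′ h * α h) (λ h → m′ h * β h)) ⟩
          (sum (λ h → m′ h * α h) + sum (λ h → m′ h * β h)) * Z x y ∎
          where
          Z : Matrix v
          Z = X a · Y b
          α β : Fin (suc d) → ℤ
          α h = proj₁ (αβ h) a
          β h = proj₁ (proj₂ (αβ h)) b
          ring₁ : ∀ s z m → s ≡ + 1 * s + + 0 * z + - m * + 0
          ring₁ = solve-∀
          ring₂ : ∀ m a b z → m * ((a + b) * z) ≡ (m * a + m * b) * z
          ring₂ = solve-∀
          ring₃ : ∀ a b z s → + 0 * s ≡ (+ 0 * a + + 0 * b) * z
          ring₃ = solve-∀
          term : ∀ h → Dec (h ≡ e) → m′ h * (A h · Z) x y ≡ (m′ h * α h + m′ h * β h) * Z x y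
          term h (yes h≡e) = subst (λ c → c * (A h · Z) x y ≡ (c * α h + c * β h) * Z x y)
            (sym (trans (cong m′ h≡e) m′e≡0)) (ring₃ (α h) (β h) (Z x y) ((A h · Z) x y))
          term h (no h≢e) = trans (cong (m′ h *_) (proj₂ (proj₂ (αβ h)) h≢e a b x y))
            (ring₂ (m′ h) (α h) (β h) (Z x y))

      -- M = X true · Y true acts on the four blocks X a · Y b with eigenvalues v², 0, 0, 0,
      -- which are not of the form α a + β b.
      not-all-nonzero : (∀ a b → (X a · Y b) x₀ x₀ ≢ + 0) → ⊥
      not-all-nonzero nonzero = *-≢0 v≢0 v≢0 (begin
        + v * + v                                       ≡⟨ sym tt ⟩
        α true + β true                                 ≡⟨ ring₁ (α true) (α false) (β true) (β false) ⟩
        (α true + β false) + (α false + β true) - (α false + β false) ≡⟨ cong₂ _-_ (cong₂ _+_ tf ft) ff ⟩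
        + 0                                             ∎)
        where
        action : Σ (Bool → ℤ) λ α → Σ (Bool → ℤ) λ β →
          ∀ a b x y → (X true · Y true · (X a · Y b)) x y ≡ (α a + β b) * (X a · Y b) x y
        action = measurable⇒additive (·-measurable (measurable true) (Y-measurable true))
        α β : Bool → ℤ
        α = proj₁ action
        β = proj₁ (proj₂ action)
        eig : ∀ a b x y → (X true · Y true · (X a · Y b)) x y ≡ (α a + β b) * (X a · Y b) x y
        eig = proj₂ (proj₂ action)
        ring₁ : ∀ a a′ b b′ → a + b ≡ (a + b′) + (a′ + b) - (a′ + b′)
        ring₁ = solve-∀
        eigenvalue : ∀ a b c → (X true · Y true · (X a · Y b)) x₀ x₀ ≡ c * (X a · Y b) x₀ x₀ → α a + β b ≡ c
        eigenvalue a b c eq = *-cancelʳ ((X a · Y b) x₀ x₀) (nonzero a b) (trans (sym (eig a b x₀ x₀)) eq)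
        tt : α true + β true ≡ + v * + v
        tt = eigenvalue true true _ (idempotent-· (measurable true) (Y-measurable true) idempotent Y-idempotent x₀ x₀)
        X-orth : ∀ b → (X true · Y true · (X false · Y b)) x₀ x₀ ≡ + 0
        X-orth b = trans (·-interchange (X true) (Y-measurable true) (measurable false) (Y b) x₀ x₀)
          (trans (sum-cong (λ z → cong (_* (Y true · Y b) z x₀) (orthogonal x₀ z))) (sum-zero v))
        tf : α true + β false ≡ + 0
        tf = eigenvalue true false _ (trans (·-interchange (X true) (Y-measurable true) (measurable true) (Y false) x₀ x₀)
          (trans (sum-cong (λ z → trans (cong ((X true · X true) x₀ z *_) (Y-orthogonal z x₀)) (ℤₚ.*-zeroʳ ((X true · X true) x₀ z)))) (sum-zero v)))
        ft : α false + β true ≡ + 0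
        ft = eigenvalue false true _ (X-orth true)
        ff : α false + β false ≡ + 0
        ff = eigenvalue false false _ (X-orth false)

  -- Diagonal entries of the four blocks

  module _ {i j n m t s} (gi : Good i n t) (gj : Good j m s) (i≢0 : i ≢ zero) (j≢0 : j ≢ zero) (i≢j : i ≢ j) where
    private
      module Gi = Good gi
      module Gj = Good gj

    C·G-diagonal : ∀ x → (Gi.C · Gj.G) x x ≡ + v * (s * (m - + 1)) - n * t * s * (m - n)
    C·G-diagonal x = trans (Gi.C-· Gj.G-null x x)
      (cong₂ (λ g h → + v * g - h) (Gj.G-diagonal j≢0 x) (G·G-diagonal gi gj i≢0 j≢0 i≢j x))

  module _ {i j n t s} (gi : Good i n t) (gj : Good j (- n) s) (i≢0 : i ≢ zero) (j≢0 : j ≢ zero) (i≢j : i ≢ j) where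
    private
      module Gi = Good gi
      module Gj = Good gj

    GG : ∀ x → (Gi.G · Gj.G) x x ≡ n * t * s * (- n - n)
    GG = G·G-diagonal gi gj i≢0 j≢0 i≢j

    CG : ∀ x → (Gi.C · Gj.G) x x ≡ n * n * (s * (+ 2 * t - (n + + 1)))
    CG x = trans (C·G-diagonal gi gj i≢0 j≢0 i≢j x)
      (trans (cong (λ w → w * (s * (- n - + 1)) - n * t * s * (- n - n)) (sym Gi.order)) (ring₁ n t s))
      where
      ring₁ : ∀ n t s → n * n * (s * (- n - + 1)) - n * t * s * (- n - n) ≡ n * n * (s * (+ 2 * t - (n + + 1)))
      ring₁ = solve-∀

    GC : ∀ x → (Gi.G · Gj.C) x x ≡ n * n * (t * (+ 2 * s - (- n + + 1)))
    GC x = trans (·-comm Gi.G-measurable Gj.C-measurable x x) (trans (C·G-diagonal gj gi j≢0 i≢0 (i≢j ∘ sym) x)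
      (trans (cong (λ w → w * (t * (n - + 1)) - - n * s * t * (n - - n)) (sym Gi.order)) (ring₁ n t s)))
      where
      ring₁ : ∀ n t s → n * n * (t * (n - + 1)) - - n * s * t * (n - - n) ≡ n * n * (t * (+ 2 * s - (- n + + 1)))
      ring₁ = solve-∀

    CC : ∀ x → (Gi.C · Gj.C) x x ≡ n * n * (n * n - + 1 - s * (- n - + 1)) - n * n * (t * (+ 2 * s - (- n + + 1)))
    CC x = trans (Gi.C-· Gj.C-null x x) (cong₂ _-_
      (trans (cong (+ v *_) (Gj.C-diagonal j≢0 x)) (cong (λ w → w * (w - + 1 - s * (- n - + 1))) (sym Gi.order)))
      (GC x))

    GG≢0 : ∀ x → (Gi.G · Gj.G) x x ≢ + 0
    GG≢0 x eq = *-≢0 (*-≢0 (*-≢0 Gi.n≢0 (Gi.t≢0 i≢0)) (Gj.t≢0 j≢0)) -n-n≢0 (trans (sym (GG x)) eq)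
      where
      ring₁ : ∀ n → - n - n ≡ - + 2 * n
      ring₁ = solve-∀
      -2≢0 : - + 2 ≢ + 0
      -2≢0 ()
      -n-n≢0 : - n - n ≢ + 0
      -n-n≢0 eq = *-≢0 -2≢0 Gi.n≢0 (trans (sym (ring₁ n)) eq)

    -- As `n` and `s` are nonzero, this entry vanishes only for `n + 1 = 2 t`, when class `i` admits
    -- parameters of both signs.
    CG≢0 : n + + 1 ≢ + 2 * t → ∀ x → (Gi.C · Gj.G) x x ≢ + 0
    CG≢0 pure x eq = *-≢0 (*-≢0 Gi.n≢0 Gi.n≢0) (*-≢0 (Gj.t≢0 j≢0) (λ z → pure (sym (ℤₚ.i-j≡0⇒i≡j _ _ z))))
      (trans (sym (CG x)) eq)

    GC≢0 : - n + + 1 ≢ + 2 * s → ∀ x → (Gi.G · Gj.C) x x ≢ + 0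
    GC≢0 pure x eq = *-≢0 (*-≢0 Gi.n≢0 Gi.n≢0) (*-≢0 (Gi.t≢0 i≢0) (λ z → pure (sym (ℤₚ.i-j≡0⇒i≡j _ _ z))))
      (trans (sym (GC x)) eq)

    -- The diagonal entries satisfy 2 (CG)(GC) + (GG) v (v - 1) = 2 (GG)(CC), and those of CG, GC and GG are nonnegative.
    CC≢0 : ∀ x → (Gi.C · Gj.C) x x ≢ + 0
    CC≢0 x eq = *-≢0 (*-≢0 w≢0 (GG≢0 x)) (*-≢0 w≢0 (*-≢0 v≢0 v-1≢0))
      (proj₂ (+-≡0 (*-≥0 {+ 2} (+≤+ ℕ.z≤n) (*-≥0 cg≥0 gc≥0)) (*-≥0 gg≥0 (*-≥0 w≥0 (*-≥0 {+ v} (+≤+ ℕ.z≤n) (inhabited⇒-1≥0 x₀)))) (begin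
        + 2 * (w * cg * (w * gc)) + w * gg * (w * (+ v * (+ v - + 1)))
          ≡⟨ cong₂ (λ a b → + 2 * (w * a * (w * b)) + w * gg * (w * (+ v * (+ v - + 1)))) (CG x) (GC x) ⟩
        + 2 * (w * cg′ * (w * gc′)) + w * gg * (w * (+ v * (+ v - + 1)))
          ≡⟨ cong₂ (λ a b → + 2 * (w * cg′ * (w * gc′)) + w * a * (w * (b * (b - + 1)))) (GG x) (sym Gi.order) ⟩
        + 2 * (w * cg′ * (w * gc′)) + w * gg′ * (w * (n * n * (n * n - + 1)))
          ≡⟨ ring₁ n t s w ⟩
        + 2 * (w * gg′ * (w * cc′))
          ≡⟨ cong (λ a → + 2 * (w * gg′ * (w * a))) (trans (sym (CC x)) eq) ⟩
        + 2 * (w * gg′ * (w * + 0))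
          ≡⟨ ring₂ (w * gg′) w ⟩
        + 0 ∎)))
      where
      w cg gc gg cg′ gc′ gg′ cc′ : ℤ
      -- A product of two of the projections satisfies `P · P = w P`, so nonnegativity is available
      -- for `w` times its diagonal entries.
      w = + v * + v
      cg = (Gi.C · Gj.G) x x
      gc = (Gi.G · Gj.C) x x
      gg = (Gi.G · Gj.G) x x
      cg′ = n * n * (s * (+ 2 * t - (n + + 1)))
      gc′ = n * n * (t * (+ 2 * s - (- n + + 1)))
      gg′ = n * t * s * (- n - n)
      cc′ = n * n * (n * n - + 1 - s * (- n - + 1)) - n * n * (t * (+ 2 * s - (- n + + 1)))
      ring₁ : ∀ n t s w →
        + 2 * (w * (n * n * (s * (+ 2 * t - (n + + 1)))) * (w * (n * n * (t * (+ 2 * s - (- n + + 1)))))) +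
        w * (n * t * s * (- n - n)) * (w * (n * n * (n * n - + 1))) ≡
        + 2 * (w * (n * t * s * (- n - n)) *
          (w * (n * n * (n * n - + 1 - s * (- n - + 1)) - n * n * (t * (+ 2 * s - (- n + + 1))))))
      ring₁ = solve-∀
      ring₂ : ∀ a w → + 2 * (a * (w * + 0)) ≡ + 0
      ring₂ = solve-∀
      w≢0 : w ≢ + 0
      w≢0 = *-≢0 v≢0 v≢0
      w≥0 : + 0 ≤ w
      w≥0 = square-≥0 (+ v)
      cg≥0 : + 0 ≤ w * cg
      cg≥0 = idempotent-diagonal-≥0 (·-measurable Gi.C-measurable Gj.G-measurable) w
        (idempotent-· Gi.C-measurable Gj.G-measurable Gi.C-idempotent Gj.G-idempotent) x
      gc≥0 : + 0 ≤ w * gc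
      gc≥0 = idempotent-diagonal-≥0 (·-measurable Gi.G-measurable Gj.C-measurable) w
        (idempotent-· Gi.G-measurable Gj.C-measurable Gi.G-idempotent Gj.C-idempotent) x
      gg≥0 : + 0 ≤ w * gg
      gg≥0 = idempotent-diagonal-≥0 (·-measurable Gi.G-measurable Gj.G-measurable) w
        (idempotent-· Gi.G-measurable Gj.G-measurable Gi.G-idempotent Gj.G-idempotent) x
      ring₃ : ∀ n → n * n - + 1 ≡ - (n - + 1) * (- n - + 1)
      ring₃ = solve-∀
      -- Up to sign, `v - 1` is the product of `n - 1` and `- n - 1`, which are factors of the
      -- nonzero degrees of the two classes.
      v-1≢0 : + v - + 1 ≢ + 0
      v-1≢0 z = *-≢0 (λ e → Gi.n-1≢0 i≢0 (ℤₚ.neg-injective e)) (Gj.n-1≢0 j≢0)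
        (trans (sym (ring₃ n)) (trans (cong (_- + 1) Gi.order) z))

  -- Here `m` is only propositionally `- n`, which fits orders taken from a family such as `N j`.
  blocks≢0 : ∀ {i j n m t s} (gi : Good i n t) (gj : Good j m s) → m ≡ - n → i ≢ zero → j ≢ zero → i ≢ j → ∀ x →
    (Good.G gi · Good.G gj) x x ≢ + 0 ×
    (m + + 1 ≢ + 2 * s → (Good.G gi · Good.C gj) x x ≢ + 0) ×
    (n + + 1 ≢ + 2 * t → (Good.C gi · Good.G gj) x x ≢ + 0) ×
    (Good.C gi · Good.C gj) x x ≢ + 0
  blocks≢0 gi gj refl i≢0 j≢0 i≢j x =
    GG≢0 gi gj i≢0 j≢0 i≢j x ,
    (λ pure → GC≢0 gi gj i≢0 j≢0 i≢j pure x) ,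
    (λ pure → CG≢0 gi gj i≢0 j≢0 i≢j pure x) ,
    CC≢0 gi gj i≢0 j≢0 i≢j x

  -- Pairs of orthogonal projections built from the classes

  module _ {i n t} (g : Good i n t) where
    open Good g

    pair : ∀ M → Measurable M → Null M → (∀ x y → (G · M) x y ≡ + 0) → Pair
    pair M Mm null G·M≡0 = record
      { X = λ { true → G ; false → M }
      ; measurable = λ { true → G-measurable ; false → Mm }
      ; null = λ { true → G-null ; false → null }
      ; idempotent = G-idempotent
      ; orthogonal = G·M≡0
      }

  -- For `h = i` the eigenvalue is `n - t`. Otherwise the two `G` are orthogonal, which puts the one
  -- of `i` into the eigenspace of `- s` of `A h`.
  G-eigen : ∀ {h i n s t} → Good h n s → (g : Good i n t) → h ≢ zero → i ≢ zero →
    Σ ℤ λ c → ∀ x y → (A h · Good.G g) x y ≡ c * Good.G g x y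
  G-eigen {h} {i} {n} {s} {t} gh g h≢0 i≢0 with h ≟ i
  ... | yes refl = n - t , Good.A-eigen g
  ... | no h≢i = - s , Good.A-eigen-annihilated gh (Good.G-null g) (G-orthogonal gh g h≢0 i≢0 h≢i)

  square-≡ : ∀ {n m} → n * n ≡ m * m → m ≡ n ⊎ m ≡ - n
  square-≡ {n} {m} eq with ℤₚ.i*j≡0⇒i≡0∨j≡0 (m - n) (trans (ring₁ n m) (ℤₚ.i≡j⇒i-j≡0 (sym eq)))
    where
    ring₁ : ∀ n m → (m - n) * (m + n) ≡ m * m - n * n
    ring₁ = solve-∀
  ... | inj₁ z = inj₁ (ℤₚ.i-j≡0⇒i≡j m n z)
  ... | inj₂ z = inj₂ (ℤₚ.i-j≡0⇒i≡j m (- n) (trans (cong (_+_ m) (ℤₚ.neg-involutive n)) z))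

  module _ (e : Fin (suc d)) (N T : Fin (suc d) → ℤ)
           (good : ∀ h → h ≢ zero → h ≢ e → Good h (N h) (T h)) where

    goodAs : ∀ {n} h → h ≢ zero → h ≢ e → N h ≡ n → Good h n (T h)
    goodAs h h≢0 h≢e Nh≡n = subst (λ n → Good h n (T h)) Nh≡n (good h h≢0 h≢e)

    -- Records which matrix completes the pair of `i`: the `G` of another class of the same signed
    -- order, or `C` when no such class exists.
    data Second (i : Fin (suc d)) : Set where
      other : ∀ h → h ≢ zero → h ≢ e → i ≢ h → N h ≡ N i → Second i
      none  : (∀ h → h ≢ zero → h ≢ e → i ≢ h → N h ≢ N i) → Second i

    second : ∀ i → Second i
    second i with any? (λ h → ¬? (h ≟ zero) ×-dec ¬? (h ≟ e) ×-dec ¬? (i ≟ h) ×-dec (N h ℤₚ.≟ N i))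
    ... | yes (h , h≢0 , h≢e , i≢h , eq) = other h h≢0 h≢e i≢h eq
    ... | no ∄h = none (λ h h≢0 h≢e i≢h eq → ∄h (h , h≢0 , h≢e , i≢h , eq))

    module _ {i} (i≢0 : i ≢ zero) (i≢e : i ≢ e) where
      private module Gi = Good (good i i≢0 i≢e)

      class-pair : Second i → Pair
      class-pair (none _) = pair (good i i≢0 i≢e) Gi.C Gi.C-measurable Gi.C-null Gi.G·C≡0
      class-pair (other h h≢0 h≢e i≢h eq) = pair (good i i≢0 i≢e) Gh.G Gh.G-measurable Gh.G-null
        (G-orthogonal (good i i≢0 i≢e) (goodAs h h≢0 h≢e eq) i≢0 h≢0 i≢h)
        where module Gh = Good (goodAs h h≢0 h≢e eq)

      eigen : ∀ {X : Bool → Matrix v} h → (Σ ℤ λ c → ∀ x y → (A h · X true) x y ≡ c * X true x y) →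
        (Σ ℤ λ c → ∀ x y → (A h · X false) x y ≡ c * X false x y) →
        Σ (Bool → ℤ) λ α → ∀ a x y → (A h · X a) x y ≡ α a * X a x y
      eigen h (c , eig) (c′ , eig′) = (λ { true → c ; false → c′ }) , λ { true → eig ; false → eig′ }

      class-eigen : ∀ s h → h ≢ zero → h ≢ e → N h ≡ N i → Eigen (class-pair s) h
      class-eigen (other h′ h′≢0 h′≢e i≢h′ eq′) h h≢0 h≢e eq = eigen h
        (G-eigen gh (good i i≢0 i≢e) h≢0 i≢0) (G-eigen gh (goodAs h′ h′≢0 h′≢e eq′) h≢0 h′≢0)
        where
        gh : Good h (N i) (T h)
        gh = goodAs h h≢0 h≢e eq
      -- No second class has this order, so `h` is `i` itself and acts on `G` and `C` by its two
      -- restricted eigenvalues.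
      class-eigen (none ∄h) h h≢0 h≢e eq = eigen h (n-t , Gi-eigen) (- T i , C-eigen)
        where
        i≡h : Dec (i ≡ h) → i ≡ h
        i≡h (yes i≡h) = i≡h
        i≡h (no i≢h) = ⊥-elim (∄h h h≢0 h≢e i≢h eq)
        n-t : ℤ
        n-t = N i - T i
        Gi-eigen : ∀ x y → (A h · Gi.G) x y ≡ n-t * Gi.G x y
        Gi-eigen x y = subst (λ k → (A k · Gi.G) x y ≡ n-t * Gi.G x y) (i≡h (i ≟ h)) (Gi.A-eigen x y)
        C-eigen : ∀ x y → (A h · Gi.C) x y ≡ - T i * Gi.C x y
        C-eigen x y = subst (λ k → (A k · Gi.C) x y ≡ - T i * Gi.C x y) (i≡h (i ≟ h))
          (Gi.A-eigen-annihilated Gi.C-null Gi.G·C≡0 x y)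

    module _ {i j} (i≢0 : i ≢ zero) (i≢e : i ≢ e) (j≢0 : j ≢ zero) (j≢e : j ≢ e) (Nj≡-Ni : N j ≡ - N i)
             (pure-i : N i + + 1 ≢ + 2 * T i) (pure-j : N j + + 1 ≢ + 2 * T j) where
      private
        gi : Good i (N i) (T i)
        gi = good i i≢0 i≢e

        gj : Good j (N j) (T j)
        gj = good j j≢0 j≢e

      opposite : ∀ {h} → N h ≡ N j → N h ≡ - N i
      opposite eq = trans eq Nj≡-Ni

      -- A common class would have an order equal to its own negative, hence zero.
      separated : ∀ {h k} → N h ≡ N i → N k ≡ N j → h ≢ k
      separated {h} h∼i k∼j refl = *-≢0 2≢0 (Good.n≢0 gi) (begin
        + 2 * N i       ≡⟨ ring₁ (N i) ⟩
        N i - - N i     ≡⟨ ℤₚ.i≡j⇒i-j≡0 (trans (sym h∼i) (opposite k∼j)) ⟩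
        + 0             ∎)
        where
        2≢0 : + 2 ≢ + 0
        2≢0 ()
        ring₁ : ∀ n → + 2 * n ≡ n - - n
        ring₁ = solve-∀

      private
        blocks = blocks≢0 gi gj Nj≡-Ni i≢0 j≢0 (separated refl refl) x₀

        base : (Good.G gi · Good.G gj) x₀ x₀ ≢ + 0
        base = proj₁ blocks

        left : ∀ {h} (h≢0 : h ≢ zero) (h≢e : h ≢ e) (h∼i : N h ≡ N i) → (Good.G (goodAs h h≢0 h≢e h∼i) · Good.G gj) x₀ x₀ ≢ + 0
        left h≢0 h≢e h∼i = proj₁ (blocks≢0 (goodAs _ h≢0 h≢e h∼i) gj Nj≡-Ni h≢0 j≢0 (separated h∼i refl) x₀)

        right : ∀ {k} (k≢0 : k ≢ zero) (k≢e : k ≢ e) (k∼j : N k ≡ N j) → (Good.G gi · Good.G (goodAs k k≢0 k≢e k∼j)) x₀ x₀ ≢ + 0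
        right k≢0 k≢e k∼j = proj₁ (blocks≢0 gi (goodAs _ k≢0 k≢e k∼j) Nj≡-Ni i≢0 k≢0 (separated refl k∼j) x₀)

      -- Blocks `G · G` and `C · C` are nonzero because the orders are opposite; a block of one `G`
      -- and one `C` is nonzero by purity of the class whose `C` occurs. Matching on `σ` and `τ` in
      -- every clause lets `class-pair` reduce.
      nonzero : (σ : Second i) (τ : Second j) → ∀ a b →
        (Pair.X (class-pair i≢0 i≢e σ) a · Pair.X (class-pair j≢0 j≢e τ) b) x₀ x₀ ≢ + 0
      nonzero (other _ _ _ _ _) (other _ _ _ _ _) true true = base
      nonzero (other _ _ _ _ _) (none _) true true = base
      nonzero (none _) (other _ _ _ _ _) true true = base
      nonzero (none _) (none _) true true = base
      nonzero (other _ _ _ _ _) (other k k≢0 k≢e j≢k k∼j) true false = right k≢0 k≢e k∼j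
      nonzero (none _) (other k k≢0 k≢e j≢k k∼j) true false = right k≢0 k≢e k∼j
      nonzero (other _ _ _ _ _) (none _) true false = proj₁ (proj₂ blocks) pure-j
      nonzero (none _) (none _) true false = proj₁ (proj₂ blocks) pure-j
      nonzero (other h h≢0 h≢e i≢h h∼i) (other _ _ _ _ _) false true = left h≢0 h≢e h∼i
      nonzero (other h h≢0 h≢e i≢h h∼i) (none _) false true = left h≢0 h≢e h∼i
      nonzero (none _) (other _ _ _ _ _) false true = proj₁ (proj₂ (proj₂ blocks)) pure-i
      nonzero (none _) (none _) false true = proj₁ (proj₂ (proj₂ blocks)) pure-i
      nonzero (other h h≢0 h≢e i≢h h∼i) (other k k≢0 k≢e j≢k k∼j) false false =
        proj₁ (blocks≢0 (goodAs h h≢0 h≢e h∼i) (goodAs k k≢0 k≢e k∼j) Nj≡-Ni h≢0 k≢0 (separated h∼i k∼j) x₀)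
      nonzero (other h h≢0 h≢e i≢h h∼i) (none _) false false =
        proj₁ (proj₂ (blocks≢0 (goodAs h h≢0 h≢e h∼i) gj Nj≡-Ni h≢0 j≢0 (separated h∼i refl) x₀)) pure-j
      nonzero (none _) (other k k≢0 k≢e j≢k k∼j) false false =
        proj₁ (proj₂ (proj₂ (blocks≢0 gi (goodAs k k≢0 k≢e k∼j) Nj≡-Ni i≢0 k≢0 (separated refl k∼j) x₀))) pure-i
      nonzero (none _) (none _) false false = proj₂ (proj₂ (proj₂ blocks))

    -- All orders have the same square, so each class except `e` and the diagonal has the order of
    -- `i` or of `j` and acts by scalars on the corresponding pair. The diagonal class acts by `1`.
    opposite-orders : ∀ {i j} → i ≢ zero → i ≢ e → j ≢ zero → j ≢ e → N j ≡ - N i →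
      N i + + 1 ≢ + 2 * T i → N j + + 1 ≢ + 2 * T j → ⊥
    opposite-orders {i} {j} i≢0 i≢e j≢0 j≢e Nj≡-Ni pure-i pure-j = not-all-nonzero
      (class-pair i≢0 i≢e (second i)) (class-pair j≢0 j≢e (second j)) e
      (λ h h≢e → additive h h≢e (h ≟ zero))
      (nonzero i≢0 i≢e j≢0 j≢e Nj≡-Ni pure-i pure-j (second i) (second j))
      where
      gi : Good i (N i) (T i)
      gi = good i i≢0 i≢e
      P Q : Pair
      P = class-pair i≢0 i≢e (second i)
      Q = class-pair j≢0 j≢e (second j)
      additive : ∀ h → h ≢ e → Dec (h ≡ zero) → Additive P Q e h
      additive h h≢e (yes refl) = eigen⇒additive P Q e (inj₁ ((λ _ → + 1) , λ a x y →
        trans (sum-cong (λ z → cong (_* Pair.X P a z y) (A-zero x z)))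
          (trans (sum-δ x (λ z → Pair.X P a z y)) (sym (ℤₚ.*-identityˡ _)))))
      additive h h≢e (no h≢0) with square-≡ (trans (Good.order gi) (sym (Good.order (good h h≢0 h≢e))))
      ... | inj₁ h∼i = eigen⇒additive P Q e (inj₁ (class-eigen i≢0 i≢e (second i) h h≢0 h≢e h∼i))
      ... | inj₂ h∼j = eigen⇒additive P Q e (inj₂ (class-eigen j≢0 j≢e (second j) h h≢0 h≢e (trans h∼j (sym Nj≡-Ni))))

-- Merging classes of a common sign

module Merge {v d : ℕ} {R : Rel v d} (scheme : IsSymScheme v d R)
  {n : ℤ} (e : Fin (suc d)) (T : Fin (suc d) → ℤ)
  (good : ∀ h → h ≢ zero → h ≢ e → Scheme.Good scheme h n (T h))
  {c : ℕ} (f : Fin (suc d) → Fin (suc c)) (f-zero : ∀ i → f i ≡ zero ⇔ i ≡ zero) where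

  open IsSymScheme scheme
  open Scheme scheme

  -- For `h ≢ i` the relation `G h · A i = - T i G h` is solved for `A h · A i`; for `h ≡ i` the
  -- term with `δ h i` corrects this to `square`. A single formula for both cases can be summed over
  -- the classes of a part.
  A·A-good : ∀ {h i} → h ≢ zero → h ≢ e → i ≢ zero → i ≢ e → ∀ x y → (A h · A i) x y ≡
    - T i * A h x y - T h * A i x y + T h * T i * (+ 1 - δ x y) + δ h i * (n * A h x y + T h * (n * δ x y - + 1))
  A·A-good {h} {i} h≢0 h≢e i≢0 i≢e x y with h ≟ i
  ... | yes refl = trans (Good.square (good h h≢0 h≢e) x y) (ring₁ n (T h) (A h x y) (δ x y))
    where
    ring₁ : ∀ n t a e → t * (t - + 1) + (n - + 2 * t) * a + t * (n - t) * e ≡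
      - t * a - t * a + t * t * (+ 1 - e) + + 1 * (n * a + t * (n * e - + 1))
    ring₁ = solve-∀
  ... | no h≢i = ℤₚ.i-j≡0⇒i≡j _ _ (≢0-*ˡ n Gh.n≢0 (begin
      n * ((A h · A i) x y - (- T i * A h x y - T h * A i x y + T h * T i * (+ 1 - δ x y) + + 0 * g))
        ≡⟨ ring₁ n (T h) (T i) ((A h · A i) x y) (A h x y) (A i x y) (δ x y) g ⟩
      n * (A h · A i) x y + T h * n * A i x y + - T h * (T i * (n - + 1)) - - T i * Gh.G x y
        ≡⟨ ℤₚ.i≡j⇒i-j≡0 (trans (sym expanded) eigen) ⟩
      + 0 ∎))
    where
    module Gh = Good (good h h≢0 h≢e)
    module Gi = Good (good i i≢0 i≢e)
    g : ℤ
    g = n * A h x y + T h * (n * δ x y - + 1)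
    expanded : (Gh.G · A i) x y ≡ n * (A h · A i) x y + T h * n * A i x y + - T h * (T i * (n - + 1))
    expanded = trans (aff-· n (A h) (T h * n) (- T h) (A i) x y)
      (cong (λ k → n * (A h · A i) x y + T h * n * A i x y + - T h * k) (Gi.degree y))
    eigen : (Gh.G · A i) x y ≡ - T i * Gh.G x y
    eigen = trans (·-comm Gh.G-measurable (A-measurable i) x y)
      (Gi.A-eigen-annihilated Gh.G-null (G-orthogonal (good i i≢0 i≢e) (good h h≢0 h≢e) i≢0 h≢0 (h≢i ∘ sym)) x y)
    ring₁ : ∀ n t s p a b e g → n * (p - (- s * a - t * b + t * s * (+ 1 - e) + + 0 * g)) ≡
      n * p + t * n * b + - t * (s * (n - + 1)) - - s * (n * a + t * n * e + - t)
    ring₁ = solve-∀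

  -- Products of merged classes

  B : Fin (suc c) → Matrix v
  B a x y = δ (f (R x y)) a

  φ : Fin (suc c) → Fin (suc d) → ℤ
  φ a h = δ (f h) a

  B-measurable : ∀ a → Measurable (B a)
  B-measurable a = φ a , λ _ _ → refl

  -- The parameter `t` of the merged graph: for a common `n` these parameters add up.
  τ : Fin (suc c) → ℤ
  τ a = sum (λ h → φ a h * T h)

  -- Allows identities valid only for the classes of part `a` under a sum over all classes, since
  -- the remaining ones have weight zero.
  φ-cong : ∀ {a} {h} {s t : ℤ} → (f h ≡ a → s ≡ t) → φ a h * s ≡ φ a h * t
  φ-cong {a} {h} eq with f h ≟ a
  ... | yes fh≡a = cong (+ 1 *_) (eq fh≡a)
  ... | no _ = refl

  Regular : Fin (suc c) → Set
  Regular a = a ≢ zero × a ≢ f e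

  regular-class : ∀ {a h} → Regular a → f h ≡ a → h ≢ zero × h ≢ e
  regular-class (a≢0 , a≢fe) refl = (λ h≡0 → a≢0 (Equivalence.from (f-zero _) h≡0)) , λ h≡e → a≢fe (cong f h≡e)

  -- `A·A-good` is affine in `T i` and `A i`, whose sums over part `b` are `τ b` and `B b`; the term
  -- with `δ h i` survives once if `h` lies in `b`.
  A·B : ∀ {b h} → Regular b → h ≢ zero → h ≢ e → ∀ x y → (A h · B b) x y ≡
    τ b * (T h * (+ 1 - δ x y) - A h x y) + B b x y * - T h + φ b h * (n * A h x y + T h * (n * δ x y - + 1))
  A·B {b} {h} rb h≢0 h≢e x y = begin
    (A h · B b) x y ≡⟨ combination-·ʳ (φ b) A (expand (B-measurable b)) (A h) x y ⟩
    sum (λ i → φ b i * (A h · A i) x y)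
      ≡⟨ sum-cong (λ i → trans (φ-cong (λ fi≡b → A·A-good h≢0 h≢e (proj₁ (regular-class rb fi≡b)) (proj₂ (regular-class rb fi≡b)) x y))
                               (ring₁ (φ b i) (T i) (A h x y) (T h) (A i x y) (δ x y) (δ h i) g)) ⟩
    sum (λ i → φ b i * T i * s + φ b i * A i x y * - T h + δ h i * (φ b i * g))
      ≡⟨ ∑-distrib-+ (λ i → φ b i * T i * s + φ b i * A i x y * - T h) (λ i → δ h i * (φ b i * g)) ⟩
    sum (λ i → φ b i * T i * s + φ b i * A i x y * - T h) + sum (λ i → δ h i * (φ b i * g))
      ≡⟨ cong₂ _+_ (∑-distrib-+ (λ i → φ b i * T i * s) (λ i → φ b i * A i x y * - T h)) (sum-δ h (λ i → φ b i * g)) ⟩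
    sum (λ i → φ b i * T i * s) + sum (λ i → φ b i * A i x y * - T h) + φ b h * g
      ≡⟨ cong (λ r → r + φ b h * g) (cong₂ _+_ (*-distribʳ-sum s (λ i → φ b i * T i)) (*-distribʳ-sum (- T h) (λ i → φ b i * A i x y))) ⟨
    τ b * s + sum (λ i → φ b i * A i x y) * - T h + φ b h * g
      ≡⟨ cong (λ r → τ b * s + r * - T h + φ b h * g) (expand (B-measurable b) x y) ⟨
    τ b * s + B b x y * - T h + φ b h * g ∎
    where
    s g : ℤ
    s = T h * (+ 1 - δ x y) - A h x y
    g = n * A h x y + T h * (n * δ x y - + 1)
    ring₁ : ∀ p ti ah th ai e q g → p * (- ti * ah - th * ai + th * ti * (+ 1 - e) + q * g) ≡
      p * ti * (th * (+ 1 - e) - ah) + p * ai * - th + q * (p * g)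
    ring₁ = solve-∀

  -- `A·B` is summed over the classes `h` of part `a`, for which the weight `φ b h` is the constant
  -- `δ a b`.
  B·B-regular : ∀ {a b} → Regular a → Regular b → ∀ x y → (B a · B b) x y ≡
    B a x y * (δ a b * n - τ b) + τ a * (τ b * (+ 1 - δ x y) - B b x y + δ a b * (n * δ x y - + 1))
  B·B-regular {a} {b} ra rb x y = begin
    (B a · B b) x y ≡⟨ combination-·ˡ (φ a) A (expand (B-measurable a)) (B b) x y ⟩
    sum (λ h → φ a h * (A h · B b) x y) ≡⟨ sum-cong (λ h → trans (φ-cong (term h)) (ring₁ (φ a h) (τ b) (T h) (δ x y) (A h x y) (B b x y) (δ a b) n)) ⟩
    sum (λ h → φ a h * A h x y * s + φ a h * T h * r)
      ≡⟨ ∑-distrib-+ (λ h → φ a h * A h x y * s) (λ h → φ a h * T h * r) ⟩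
    sum (λ h → φ a h * A h x y * s) + sum (λ h → φ a h * T h * r)
      ≡⟨ cong₂ _+_ (*-distribʳ-sum s (λ h → φ a h * A h x y)) (*-distribʳ-sum r (λ h → φ a h * T h)) ⟨
    sum (λ h → φ a h * A h x y) * s + τ a * r
      ≡⟨ cong (λ q → q * s + τ a * r) (expand (B-measurable a) x y) ⟨
    B a x y * s + τ a * r ∎
    where
    s r : ℤ
    s = δ a b * n - τ b
    r = τ b * (+ 1 - δ x y) - B b x y + δ a b * (n * δ x y - + 1)
    term : ∀ h → f h ≡ a → (A h · B b) x y ≡
      τ b * (T h * (+ 1 - δ x y) - A h x y) + B b x y * - T h + δ a b * (n * A h x y + T h * (n * δ x y - + 1))
    term h fh≡a = trans (A·B rb (proj₁ (regular-class ra fh≡a)) (proj₂ (regular-class ra fh≡a)) x y)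
      (cong (λ k → τ b * (T h * (+ 1 - δ x y) - A h x y) + B b x y * - T h + δ k b * (n * A h x y + T h * (n * δ x y - + 1))) fh≡a)
    ring₁ : ∀ p tb th e ah bb q n → p * (tb * (th * (+ 1 - e) - ah) + bb * - th + q * (n * ah + th * (n * e - + 1))) ≡
      p * ah * (q * n - tb) + p * th * (tb * (+ 1 - e) - bb + q * (n * e - + 1))
    ring₁ = solve-∀

  B-zero : ∀ x y → B zero x y ≡ δ x y
  B-zero x y = trans (⟦⟧-⇔ (f (R x y) ≟ zero) (R x y ≟ zero) (Equivalence.to (f-zero _)) (Equivalence.from (f-zero _))) (A-zero x y)

  -- Constancy on the merged classes. For the products `B a · B b` it amounts to the existence of
  -- intersection numbers.
  Closed : Matrix v → Set
  Closed M = ∀ x y x′ y′ → f (R x y) ≡ f (R x′ y′) → M x y ≡ M x′ y′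

  B-closed : ∀ a → Closed (B a)
  B-closed a _ _ _ _ = cong (λ k → δ k a)

  δ-closed : Closed δ
  δ-closed x y x′ y′ eq = trans (sym (B-zero x y)) (trans (B-closed zero x y x′ y′ eq) (B-zero x′ y′))

  B·B-comm : ∀ a b → Closed (B a · B b) → Closed (B b · B a)
  B·B-comm a b closed x y x′ y′ eq = trans (·-comm (B-measurable b) (B-measurable a) x y)
    (trans (closed x y x′ y′ eq) (·-comm (B-measurable a) (B-measurable b) x′ y′))

  B·B-zero : ∀ b → Closed (B zero · B b)
  B·B-zero b x y x′ y′ eq = trans (identity x y) (trans (B-closed b x y x′ y′ eq) (sym (identity x′ y′)))
    where
    identity : ∀ x y → (B zero · B b) x y ≡ B b x y
    identity x y = trans (sum-cong (λ z → cong (_* B b z y) (B-zero x z))) (sum-δ x (λ z → B b z y))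

  -- A column sum is a diagonal entry of `J M`, and all diagonal positions lie in class `zero`.
  col-measurable : ∀ {M} → Measurable M → ∀ y y′ → col M y ≡ col M y′
  col-measurable {M} Mm y y′ = trans (diag y) (trans (cong (proj₁ 𝟙·M)
    (trans (Equivalence.from (diagonal y y) refl) (sym (Equivalence.from (diagonal y′ y′) refl)))) (sym (diag y′)))
    where
    𝟙 : Matrix v
    𝟙 _ _ = + 1
    𝟙·M : Measurable (𝟙 · M)
    𝟙·M = ·-measurable {𝟙} ((λ _ → + 1) , λ _ _ → refl) Mm
    diag : ∀ y → col M y ≡ proj₁ 𝟙·M (R y y)
    diag y = trans (sum-cong (λ z → sym (ℤₚ.*-identityˡ (M z y)))) (proj₂ 𝟙·M y y)

  sum-B·B : ∀ b x y → sum (λ a → (B a · B b) x y) ≡ col (B b) y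
  sum-B·B b x y = trans (∑-comm (λ a z → B a x z * B b z y)) (sum-cong (λ z → sum-δ (f (R x z)) (λ _ → B b z y)))

  -- Summed over all parts `a`, the products give `J · B b`, which is constant; the product for
  -- `f e` is what remains after subtracting the others.
  complement-closed : ∀ b → (∀ a → a ≢ f e → Closed (B a · B b)) → ∀ a → Closed (B a · B b)
  complement-closed b closed a with a ≟ f e
  ... | no a≢fe = closed a a≢fe
  ... | yes refl = λ x y x′ y′ eq → sum-determines (f e)
    (trans (sum-B·B b x y) (trans (col-measurable (B-measurable b) y y′) (sym (sum-B·B b x′ y′))))
    (λ a a≢fe → closed a a≢fe x y x′ y′ eq)

  -- Complementation is applied to each factor in turn, with `B·B-comm` exchanging them, so `go`
  -- treats only parts other than `f e`.
  B·B-closed : ∀ a b → Closed (B a · B b)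
  B·B-closed a b = complement-closed b (λ a a≢fe → B·B-comm b a
    (complement-closed a (λ b b≢fe → go b a b≢fe a≢fe (b ≟ zero) (a ≟ zero)) b)) a
    where
    go : ∀ a b → a ≢ f e → b ≢ f e → Dec (a ≡ zero) → Dec (b ≡ zero) → Closed (B a · B b)
    go a b a≢fe b≢fe (yes refl) _ = B·B-zero b
    go a b a≢fe b≢fe (no _) (yes refl) = B·B-comm zero a (B·B-zero a)
    go a b a≢fe b≢fe (no a≢0) (no b≢0) x y x′ y′ eq = begin
      (B a · B b) x y ≡⟨ B·B-regular (a≢0 , a≢fe) (b≢0 , b≢fe) x y ⟩
      value (B a x y) (B b x y) (δ x y)
        ≡⟨ cong₂ (λ p q → value p q (δ x y)) (B-closed a x y x′ y′ eq) (B-closed b x y x′ y′ eq) ⟩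
      value (B a x′ y′) (B b x′ y′) (δ x y)
        ≡⟨ cong (value (B a x′ y′) (B b x′ y′)) (δ-closed x y x′ y′ eq) ⟩
      value (B a x′ y′) (B b x′ y′) (δ x′ y′) ≡⟨ B·B-regular (a≢0 , a≢fe) (b≢0 , b≢fe) x′ y′ ⟨
      (B a · B b) x′ y′ ∎
      where
      value : ℤ → ℤ → ℤ → ℤ
      value p q r = p * (δ a b * n - τ b) + τ a * (τ b * (+ 1 - r) - q + δ a b * (n * r - + 1))

  count-closed : ∀ a b x y x′ y′ → f (R x y) ≡ f (R x′ y′) →
    count v (λ z → (f (R x z) ≟ a) ×-dec (f (R z y) ≟ b)) ≡ count v (λ z → (f (R x′ z) ≟ a) ×-dec (f (R z y′) ≟ b))
  count-closed a b x y x′ y′ eq = ℤₚ.+-injective (trans (counted x y) (trans (B·B-closed a b x y x′ y′ eq) (sym (counted x′ y′))))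
    where
    counted : ∀ x y → + count v (λ z → (f (R x z) ≟ a) ×-dec (f (R z y) ≟ b)) ≡ (B a · B b) x y
    counted x y = trans (count-sum v (λ z → (f (R x z) ≟ a) ×-dec (f (R z y) ≟ b)))
      (sum-cong (λ z → ⟦⟧-× (f (R x z) ≟ a) (f (R z y) ≟ b)))

-- Strongly regular graphs

finite-choice : ∀ {n} {P Q : Fin n → Set} → (∀ i → P i ⊎ Q i) → (∀ i → P i) ⊎ ∃ Q
finite-choice {ℕ.zero} _ = inj₁ λ ()
finite-choice {suc n} {P} {Q} choose with choose zero | finite-choice {n} {P ∘ suc} {Q ∘ suc} (choose ∘ suc)
... | inj₂ q | _ = inj₂ (zero , q)
... | inj₁ _ | inj₂ (i , q) = inj₂ (suc i , q)
... | inj₁ p | inj₁ ps = inj₁ λ { zero → p ; (suc i) → ps i }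

module Parameters {v d : ℕ} {R : Rel v d} (scheme : IsSymScheme v d R) where

  open IsSymScheme scheme
  open Scheme scheme
  open Mixed scheme using (square-≡; opposite-orders)

  Mat≡A : ∀ i x y → Mat R i x y ≡ A i x y
  Mat≡A i x y with R x y ≟ i
  ... | yes _ = refl
  ... | no  _ = refl

  module _ {i} (i≢0 : i ≢ zero) {k l m : ℕ} (srg : IsSRG v d R i k l m) where

    col-A : ∀ y → col (A i) y ≡ + k
    col-A y = begin
      sum (λ z → A i z y)             ≡⟨ sum-cong (λ z → cong (λ h → δ h i) (symmetric z y)) ⟩
      sum (λ z → A i y z)             ≡⟨ count-sum v (λ z → R y z ≟ i) ⟨
      + count v (λ z → R y z ≟ i)     ≡⟨ cong +_ (proj₁ srg y) ⟩
      + k                             ∎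

    -- The strongly regular graph equation `A² = k I + l A + m (J - I - A)`, collected by `A`, `I`
    -- and `J`.
    A²-aff : ∀ x y → (A i · A i) x y ≡ aff (+ l - + m) (A i) (+ k - + m) (+ m) x y
    A²-aff x y with R x y ≟ i | x ≟ y
    ... | yes refl | yes refl = ⊥-elim (i≢0 (Equivalence.from (diagonal x x) refl))
    ... | yes eq   | no _     = trans (trans (sym (count-A·A i i x y)) (cong +_ (proj₁ (proj₂ srg) x y eq))) (ring₁ (+ l) (+ m) (+ k))
      where
      ring₁ : ∀ l m k → l ≡ (l - m) * + 1 + (k - m) * + 0 + m
      ring₁ = solve-∀
    ... | no _     | yes refl = trans (trans (sum-cong diag) (col-A x)) (ring₁ (+ l) (+ m) (+ k))
      where
      diag : ∀ z → A i x z * A i z x ≡ A i z x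
      diag z = trans (cong (λ h → δ h i * A i z x) (symmetric x z)) idem
        where
        idem : A i z x * A i z x ≡ A i z x
        idem with R z x ≟ i
        ... | yes _ = refl
        ... | no  _ = refl
      ring₁ : ∀ l m k → k ≡ (l - m) * + 0 + (k - m) * + 1 + m
      ring₁ = solve-∀
    ... | no R≢i   | no x≢y   = trans (trans (sym (count-A·A i i x y)) (cong +_ (proj₂ (proj₂ srg) x y x≢y R≢i))) (ring₁ (+ l) (+ m) (+ k))
      where
      ring₁ : ∀ l m k → m ≡ (l - m) * + 0 + (k - m) * + 0 + m
      ring₁ = solve-∀

    eigenvalue-equation : ∀ {θ} → IsRestrictedEigenvalue v d R i θ → θ * θ ≡ (+ l - + m) * θ + (+ k - + m)
    eigenvalue-equation {θ} (u , (x , ux≢0) , sum-u , eig) = *-cancelʳ (u x) ux≢0 (begin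
      θ * θ * u x                                      ≡⟨ ℤₚ.*-assoc θ θ (u x) ⟩
      θ * (θ * u x)                                    ≡⟨ cong (θ *_) (AU x) ⟨
      θ * (A i · U) x x                                ≡⟨ sum-*ˡ θ (λ z → A i x z * u z) ⟨
      sum (λ z → θ * (A i x z * u z))                  ≡⟨ sum-cong (λ z → trans (swap θ (A i x z) (u z)) (cong (A i x z *_) (sym (AU z)))) ⟩
      (A i · (A i · U)) x x                            ≡⟨ ·-assoc (A i) (A i) U x x ⟨
      (A i · A i · U) x x                              ≡⟨ sum-cong (λ z → cong (_* u z) (A²-aff x z)) ⟩
      (aff (+ l - + m) (A i) (+ k - + m) (+ m) · U) x x ≡⟨ aff-· (+ l - + m) (A i) (+ k - + m) (+ m) U x x ⟩
      (+ l - + m) * (A i · U) x x + (+ k - + m) * u x + + m * sum u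
        ≡⟨ cong₂ (λ a s → (+ l - + m) * a + (+ k - + m) * u x + + m * s) (AU x) (trans (sym (sumℤ-sum v u)) sum-u) ⟩
      (+ l - + m) * (θ * u x) + (+ k - + m) * u x + + m * + 0
        ≡⟨ ring₁ (+ l - + m) θ (+ k - + m) (u x) (+ m) ⟩
      ((+ l - + m) * θ + (+ k - + m)) * u x ∎)
      where
      -- The eigenvector is repeated in every column so that the matrix lemmas apply to it.
      U : Matrix v
      U z _ = u z
      AU : ∀ z → (A i · U) z x ≡ θ * u z
      AU z = trans (sum-cong (λ y → cong (_* u y) (sym (Mat≡A i z y))))
        (trans (sym (sumℤ-sum v (λ y → Mat R i z y * u y))) (eig z))
      swap : ∀ a b c → a * (b * c) ≡ b * (a * c)
      swap = solve-∀
      ring₁ : ∀ a θ b u m → a * (θ * u) + b * u + m * + 0 ≡ (a * θ + b) * u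
      ring₁ = solve-∀

  -- Both `n - t` and `- t` solve the quadratic of `eigenvalue-equation`. Their difference `n` is
  -- nonzero, so subtracting the two equations fixes `l - m`; then `k - m` follows, and the degree
  -- gives `m`.
  LSParams⇒Good : ∀ {i n t} → i ≢ zero → LSParams v d R i n t → Good i n t
  LSParams⇒Good {i} {n} {t} i≢0 (k , l , m , srg , v≡n² , k≡ , eig₁ , eig₂ , _) = record
    { order = sym v≡n²
    ; degree = λ y → trans (col-A i≢0 srg y) k≡
    ; square = λ x y → begin
        (A i · A i) x y ≡⟨ A²-aff i≢0 srg x y ⟩
        a * A i x y + b * δ x y + + m
          ≡⟨ cong₂ (λ a b → a * A i x y + b * δ x y + + m) a≡ b≡ ⟩
        (n - + 2 * t) * A i x y + t * (n - t) * δ x y + + m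
          ≡⟨ cong (_+_ ((n - + 2 * t) * A i x y + t * (n - t) * δ x y)) m≡ ⟩
        (n - + 2 * t) * A i x y + t * (n - t) * δ x y + t * (t - + 1)
          ≡⟨ rotate ((n - + 2 * t) * A i x y) (t * (n - t) * δ x y) (t * (t - + 1)) ⟩
        t * (t - + 1) + (n - + 2 * t) * A i x y + t * (n - t) * δ x y ∎
    }
    where
    a b : ℤ
    a = + l - + m
    b = + k - + m
    rotate : ∀ p q r → p + q + r ≡ r + p + q
    rotate = solve-∀
    n≢0 : n ≢ + 0
    n≢0 n≡0 = v≢0 (trans v≡n² (cong (_* n) n≡0))
    eq₁ : (n - t) * (n - t) ≡ a * (n - t) + b
    eq₁ = eigenvalue-equation i≢0 srg eig₁
    eq₂ : - t * - t ≡ a * - t + b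
    eq₂ = eigenvalue-equation i≢0 srg eig₂
    a≡ : a ≡ n - + 2 * t
    a≡ = *-cancelʳ n n≢0 (begin
      a * n                                        ≡⟨ ring₁ a n t b ⟩
      (a * (n - t) + b) - (a * - t + b)            ≡⟨ cong₂ _-_ eq₁ eq₂ ⟨
      (n - t) * (n - t) - - t * - t                ≡⟨ ring₂ n t ⟩
      (n - + 2 * t) * n                            ∎)
      where
      ring₁ : ∀ a n t b → a * n ≡ (a * (n - t) + b) - (a * - t + b)
      ring₁ = solve-∀
      ring₂ : ∀ n t → (n - t) * (n - t) - - t * - t ≡ (n - + 2 * t) * n
      ring₂ = solve-∀
    b≡ : b ≡ t * (n - t)
    b≡ = begin
      b                                ≡⟨ ring₁ a t b ⟩
      (a * - t + b) + a * t            ≡⟨ cong₂ (λ p q → p + q * t) (sym eq₂) a≡ ⟩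
      - t * - t + (n - + 2 * t) * t    ≡⟨ ring₂ n t ⟩
      t * (n - t)                      ∎
      where
      ring₁ : ∀ a t b → b ≡ (a * - t + b) + a * t
      ring₁ = solve-∀
      ring₂ : ∀ n t → - t * - t + (n - + 2 * t) * t ≡ t * (n - t)
      ring₂ = solve-∀
    m≡ : + m ≡ t * (t - + 1)
    m≡ = begin
      + m                                  ≡⟨ ring₁ (+ k) (+ m) ⟩
      + k - b                              ≡⟨ cong₂ _-_ k≡ b≡ ⟩
      t * (n - + 1) - t * (n - t)          ≡⟨ ring₂ n t ⟩
      t * (t - + 1)                        ∎
      where
      ring₁ : ∀ k m → m ≡ k - (k - m)
      ring₁ = solve-∀
      ring₂ : ∀ n t → t * (n - + 1) - t * (n - t) ≡ t * (t - + 1)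
      ring₂ = solve-∀

  -- When n + 1 = 2 t the graph has the parameters of both types.
  flip : ∀ {i n t} → Good i n t → n + + 1 ≡ + 2 * t → Good i (- n) (t - n)
  flip {i} {n} {t} g n+1≡2t = record
    { order = trans (ring₁ n) order
    ; degree = λ y → trans (degree y) (sym (shift t (t - n) (n - + 1) (- n - + 1) (ring₂ n t)))
    ; square = λ x y → trans (square x y) (cong₂ (λ p q → p + q * A i x y + t * (n - t) * δ x y)
        (sym (shift t (t - n) (t - + 1) (t - n - + 1) (ring₃ n t))) (ring₄ n t))
        ∙ cong (λ q → (t - n) * (t - n - + 1) + (- n - + 2 * (t - n)) * A i x y + q * δ x y) (ring₅ n t)
    }
    where
    open Good g
    _∙_ = trans
    z≡0 : n + + 1 - + 2 * t ≡ + 0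
    z≡0 = ℤₚ.i≡j⇒i-j≡0 n+1≡2t
    shift : ∀ p p′ q q′ → p′ * q′ ≡ p * q + n * (n + + 1 - + 2 * t) → p′ * q′ ≡ p * q
    shift p p′ q q′ eq = trans eq (trans (cong (λ z → p * q + n * z) z≡0) (ring₀ (p * q) n))
      where
      ring₀ : ∀ a n → a + n * + 0 ≡ a
      ring₀ = solve-∀
    ring₁ : ∀ n → - n * - n ≡ n * n
    ring₁ = solve-∀
    ring₂ : ∀ n t → (t - n) * (- n - + 1) ≡ t * (n - + 1) + n * (n + + 1 - + 2 * t)
    ring₂ = solve-∀
    ring₃ : ∀ n t → (t - n) * (t - n - + 1) ≡ t * (t - + 1) + n * (n + + 1 - + 2 * t)
    ring₃ = solve-∀
    ring₄ : ∀ n t → n - + 2 * t ≡ - n - + 2 * (t - n)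
    ring₄ = solve-∀
    ring₅ : ∀ n t → t * (n - t) ≡ (t - n) * (- n - (t - n))
    ring₅ = solve-∀

  -- Reduction to a common signed order

  Uniform : Set
  Uniform = Σ (Fin (suc d)) λ e → Σ ℤ λ n → Σ (Fin (suc d) → ℤ) λ T → ∀ h → h ≢ zero → h ≢ e → Good h n (T h)

  module _ (e : Fin (suc d)) (N T : Fin (suc d) → ℤ)
           (good : ∀ h → h ≢ zero → h ≢ e → Good h (N h) (T h)) where

    -- First all classes of order `- n` are flipped to `n`. If some `j` cannot be flipped, the
    -- target becomes `- n` instead; a class of order `n` that cannot be flipped either would
    -- contradict `opposite-orders` together with `j`.
    common-sign : ∀ n → (∀ h → h ≢ zero → h ≢ e → N h ≡ n ⊎ N h ≡ - n) → Uniform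
    common-sign n N≡±n with finite-choice classify
      where
      P Q : Fin (suc d) → Set
      P h = Σ ℤ λ t → h ≢ zero → h ≢ e → Good h n t
      Q h = h ≢ zero × h ≢ e × N h ≡ - n × N h + + 1 ≢ + 2 * T h
      classify : ∀ h → P h ⊎ Q h
      classify h with h ≟ zero | h ≟ e
      -- A default parameter: nothing is claimed about the diagonal class or about `e`.
      ... | yes h≡0 | _ = inj₁ (+ 0 , λ h≢0 → ⊥-elim (h≢0 h≡0))
      ... | no _ | yes h≡e = inj₁ (+ 0 , λ _ h≢e → ⊥-elim (h≢e h≡e))
      ... | no h≢0 | no h≢e with N≡±n h h≢0 h≢e | N h + + 1 ℤₚ.≟ + 2 * T h
      ...   | inj₁ eq | _ = inj₁ (T h , λ _ _ → subst (λ n → Good h n (T h)) eq (good h h≢0 h≢e))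
      ...   | inj₂ eq | yes both = inj₁ (T h - N h , λ _ _ →
                subst (λ n → Good h n (T h - N h)) (trans (cong -_ eq) (ℤₚ.neg-involutive n)) (flip (good h h≢0 h≢e) both))
      ...   | inj₂ eq | no pure = inj₂ (h≢0 , h≢e , eq , pure)
    ... | inj₁ all = e , n , (λ h → proj₁ (all h)) , λ h → proj₂ (all h)
    ... | inj₂ (j , j≢0 , j≢e , Nj≡-n , pure-j) = e , - n , (λ h → proj₁ (opposite h)) , λ h → proj₂ (opposite h)
      where
      opposite : ∀ h → Σ ℤ λ t → h ≢ zero → h ≢ e → Good h (- n) t
      opposite h with h ≟ zero | h ≟ e
      ... | yes h≡0 | _ = + 0 , λ h≢0 → ⊥-elim (h≢0 h≡0)
      ... | no _ | yes h≡e = + 0 , λ _ h≢e → ⊥-elim (h≢e h≡e)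
      ... | no h≢0 | no h≢e with N≡±n h h≢0 h≢e | N h + + 1 ℤₚ.≟ + 2 * T h
      ...   | inj₂ eq | _ = T h , λ _ _ → subst (λ n → Good h n (T h)) eq (good h h≢0 h≢e)
      ...   | inj₁ eq | yes both = T h - N h , λ _ _ →
                subst (λ n → Good h n (T h - N h)) (cong -_ eq) (flip (good h h≢0 h≢e) both)
      ...   | inj₁ eq | no pure-h = ⊥-elim (opposite-orders e N T good h≢0 h≢e j≢0 j≢e
                (trans Nj≡-n (cong -_ (sym eq))) pure-h pure-j)

    uniform : Uniform
    uniform with any? (λ h → ¬? (h ≟ zero) ×-dec ¬? (h ≟ e))
    -- No class remains to determine the order, so any integer serves.
    ... | no ∄h = e , + 0 , T , λ h h≢0 h≢e → ⊥-elim (∄h (h , h≢0 , h≢e))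
    ... | yes (i , i≢0 , i≢e) = common-sign (N i) (λ h h≢0 h≢e →
      square-≡ (trans (Good.order (good i i≢0 i≢e)) (sym (Good.order (good h h≢0 h≢e)))))

  LS : Fin (suc d) → Set
  LS i = IsLatinSquareType v d R i ⊎ IsNegLatinSquareType v d R i

  LS⇒Good : ∀ {i} → i ≢ zero → LS i → Σ ℤ λ n → Σ ℤ λ t → Good i n t
  LS⇒Good i≢0 (inj₁ (n , t , _ , _ , params)) = n , t , LSParams⇒Good i≢0 params
  LS⇒Good i≢0 (inj₂ (n , t , _ , _ , params)) = n , t , LSParams⇒Good i≢0 params

  LS⇒uniform : ∀ e → (∀ h → h ≢ zero → h ≢ e → LS h) → Uniform
  LS⇒uniform e ls = uniform e (λ h → proj₁ (params h)) (λ h → proj₁ (proj₂ (params h))) (λ h → proj₂ (proj₂ (params h)))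
    where
    params : ∀ h → Σ ℤ λ n → Σ ℤ λ t → h ≢ zero → h ≢ e → Good h n t
    params h with h ≟ zero | h ≟ e
    ... | yes h≡0 | _ = + 0 , + 0 , λ h≢0 → ⊥-elim (h≢0 h≡0)
    ... | no _ | yes h≡e = + 0 , + 0 , λ _ h≢e → ⊥-elim (h≢e h≡e)
    ... | no h≢0 | no h≢e with LS⇒Good h≢0 (ls h h≢0 h≢e)
    ...   | n , t , g = n , t , λ _ _ → g

  module _ (exceptional : ∀ i j → i ≢ zero → j ≢ zero → ¬ LS i → ¬ LS j → i ≡ j) where

    decided⇒uniform : (∀ i → Dec (LS i)) → Uniform
    decided⇒uniform LS? with any? (λ i → ¬? (i ≟ zero) ×-dec ¬? (LS? i))
    ... | yes (e , e≢0 , ¬LSe) = LS⇒uniform e (λ h h≢0 h≢e →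
      decidable-stable (LS? h) (λ ¬LSh → h≢e (exceptional h e h≢0 e≢0 ¬LSh ¬LSe)))
    -- Without an exceptional class the diagonal class takes its place, so all non-trivial classes
    -- are covered.
    ... | no ∄e = LS⇒uniform zero (λ h h≢0 _ → decidable-stable (LS? h) (λ ¬LSh → ∄e (h , h≢0 , ¬LSh)))

    -- Being of Latin square type is not decided constructively, but the counts compared in the end have decidable equality.
    ¬¬-uniform : ¬ ¬ Uniform
    ¬¬-uniform ¬uniform =
      sequence (RawMonad.rawApplicative ¬¬-Monad) (λ i → ¬¬-excluded-middle {A = LS i}) (¬uniform ∘ decided⇒uniform)

    merged-count : ∀ {c} (f : Fin (suc d) → Fin (suc c)) → (∀ i → f i ≡ zero ⇔ i ≡ zero) →
      ∀ a b x y x′ y′ → f (R x y) ≡ f (R x′ y′) →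
      count v (λ z → (f (R x z) ≟ a) ×-dec (f (R z y) ≟ b)) ≡ count v (λ z → (f (R x′ z) ≟ a) ×-dec (f (R z y′) ≟ b))
    merged-count f f-zero a b x y x′ y′ eq = decidable-stable (_ ℕₚ.≟ _) λ ≢ → ¬¬-uniform λ where
      (e , n , T , good) → ≢ (Merge.count-closed scheme e T good f f-zero a b x y x′ y′ eq)

-- Amorphicity of the scheme

theorem4p1 : (v d : ℕ) (R : Rel v d) → IsSymScheme v d R →
    ((i j : Fin (suc d)) → i ≢ zero → j ≢ zero →
    ¬ (IsLatinSquareType v d R i ⊎ IsNegLatinSquareType v d R i) →
    ¬ (IsLatinSquareType v d R j ⊎ IsNegLatinSquareType v d R j) →
    i ≡ j) →
    IsAmorphic v d R
theorem4p1 v d R scheme exceptional c f (f-surjective , f-zero) = record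
  { nonempty = nonempty′
  ; diagonal = λ x y → mk⇔
      (λ eq → Equivalence.to (diagonal x y) (Equivalence.to (f-zero (R x y)) eq))
      (λ eq → Equivalence.from (f-zero (R x y)) (Equivalence.from (diagonal x y) eq))
  ; symmetric = λ x y → cong f (symmetric x y)
  -- The intersection number is the count at one chosen pair of the merged class `h`; `merged-count`
  -- transfers it to every other pair.
  ; intersection = λ a b h → let (x₀ , y₀ , fR≡h) = nonempty′ h in
      count v (λ z → (f (R x₀ z) ≟ a) ×-dec (f (R z y₀) ≟ b)) ,
      λ x y eq → Parameters.merged-count scheme exceptional f f-zero a b x y x₀ y₀ (trans eq (sym fR≡h))
  }
  where
  open IsSymScheme scheme
  nonempty′ : ∀ a → ∃ λ x → ∃ λ y → f (R x y) ≡ a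
  nonempty′ a with f-surjective a
  ... | i , fi≡a with nonempty i
  ...   | x , y , Rxy≡i = x , y , trans (cong f Rxy≡i) fi≡a
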